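{- Let $r$ be a fixed positive integer. If there is a (polynomial-time) $(1-\gamma_r)$-approximation algorithm for Max-Nae $r$-Sat, then there is a (polynomial-time) $(1+2^{r-2}\gamma_r)$-approximation algorithm for SM2 restricted to instances in which $|S|\le r$ for all scenarios $S\in\mathcal S$.
   Context: An instance of SM2 consists of a finite set $J$ of jobs, a processing time $p_j\ge 0$ for each $j\in J$, and an explicitly listed collection $\mathcal S=\{S_1,\dots,S_k\}$ of scenarios, each scenario $S_i$ being a subset of $J$ (the number $k$ of scenarios is part of the input). For $S\subseteq J$ write $p(S)=\sum_{j\in S}p_j$. A solution is a partition $(A,\bar A)$ of $J$ (jobs in $A$ go to machine 1 and jobs in $\bar A$ go to machine 2; the same assignment is used in all scenarios; a part may be empty). SM2 asks for a partition minimizing the sum of makespans $\sum_{i=1}^k\max\{p(A\cap S_i),p(\bar A\cap S_i)\}$. Max-Nae $r$-Sat (Weighted Max Not-All-Equal $r$-Satisfiability): given Boolean variables and a list of clauses, each consisting of $r$ literals (negated or non-negated variables) and carrying a non-negative weight, find a truth assignment maximizing the total weight of satisfied clauses, where a clause is satisfied if it contains both a true literal and a false literal. For a minimization problem, a $\rho$-approximation ($\rho\ge1$) returns a solution of value at most $\rho$ times the optimum; for a maximization problem, a $(1-\gamma)$-approximation returns a solution of value at least $(1-\gamma)$ times the optimum. -}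

module Defs where

open import Data.Bool.Base using (Bool; true; false; not; if_then_else_)
open import Data.Bool.Properties using () renaming (_≟_ to _≟ᵇ_)
open import Data.Fin.Base using (Fin; toℕ)
open import Data.Fin.Subset using (Subset; _∩_; ∁; ∣_∣)
open import Data.Integer.Base using (+_)
open import Data.List.Base using (List; []; _∷_; map; foldr; tabulate)
open import Data.List.Relation.Unary.All using (All)
open import Data.Nat.Base as ℕ using (ℕ; zero; suc)
open import Data.Nat.Binary.Base using (ℕᵇ; zero; 2[1+_]; 1+[2_]; fromℕ)
open import Data.Nat.Properties using (m^n≢0)
open import Data.Product.Base using (Σ-syntax; ∃; ∃-syntax; _×_; _,_)
open import Data.Rational.Base
  using (ℚ; 0ℚ; 1ℚ; _+_; _*_; -_; 1/_; _/_; _⊔_; _≤_; _<_; Positive; ↥_; ↧ₙ_)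
open import Data.Rational.Properties as ℚ
  using (+-0-commutativeMonoid; normalize-pos; pos⇒nonZero; 1/pos⇒pos)
open import Data.Sum.Base as Sum using (_⊎_)
open import Data.Vec.Base using (Vec; lookup; toList)
open import Data.Vec.Relation.Unary.Any using (Any; any?)
open import Function.Base using (_∘_)
open import Function.Bundles using (_⇔_; mk⇔; Equivalence)
open import Relation.Binary.PropositionalEquality
  using (_≡_; sym; trans; cong; subst)
open import Relation.Nullary using (¬_; Dec; does)
open import Relation.Nullary.Decidable using (_×-dec_)

open import Algebra.Properties.CommutativeMonoid.Sum +-0-commutativeMonoid using (sum)
open import Algebra.Properties.Group using (⁻¹-involutive)
import Data.Integer.Base as ℤ

------------------------------------------------------------------------
-- Real numbers, as two-sided Dedekind cuts

record ℝ : Set₁ where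
  field
    below above     : ℚ → Set   -- below q : q < x,  above q : x < q
    below-inhabited : ∃ below
    above-inhabited : ∃ above
    below-rounded   : ∀ p → below p ⇔ (∃[ q ] (p < q × below q))
    above-rounded   : ∀ q → above q ⇔ (∃[ p ] (p < q × above p))
    disjoint        : ∀ q → ¬ (below q × above q)
    located         : ∀ p q → p < q → below p ⊎ above q

open ℝ public using (below; above)

_≤ʳ_ : ℚ → ℝ → Set
q ≤ʳ x = ¬ above x q

-- The image of a cut under an increasing bijection f of ℚ with inverse g.
private
  image : (f g : ℚ → ℚ) →
          (∀ {p q} → p < q → f p < f q) → (∀ {p q} → p < q → g p < g q) →
          (∀ q → f (g q) ≡ q) → (∀ q → g (f q) ≡ q) → ℝ → ℝ
  image f g f-mono g-mono fg gf x = record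
    { below           = below x ∘ g
    ; above           = above x ∘ g
    ; below-inhabited = let q , b = X.below-inhabited in f q , subst (below x) (sym (gf q)) b
    ; above-inhabited = let q , a = X.above-inhabited in f q , subst (above x) (sym (gf q)) a
    ; below-rounded   = λ p → mk⇔
        (λ b → let q , gp<q , b′ = Equivalence.to (X.below-rounded (g p)) b in
               f q , subst (_< f q) (fg p) (f-mono gp<q) , subst (below x) (sym (gf q)) b′)
        (λ (q , p<q , b) → Equivalence.from (X.below-rounded (g p)) (g q , g-mono p<q , b))
    ; above-rounded   = λ q → mk⇔
        (λ a → let p , p<gq , a′ = Equivalence.to (X.above-rounded (g q)) a in
               f p , subst (f p <_) (fg q) (f-mono p<gq) , subst (above x) (sym (gf p)) a′)
        (λ (p , p<q , a) → Equivalence.from (X.above-rounded (g q)) (g p , g-mono p<q , a))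
    ; disjoint        = λ q → X.disjoint (g q)
    ; located         = λ p q p<q → X.located (g p) (g q) (g-mono p<q)
    }
    where module X = ℝ x

  neg-neg : ∀ q → - (- q) ≡ q
  neg-neg = ⁻¹-involutive ℚ.+-0-group

  +-cancel-left : ∀ a b c → a + b ≡ 0ℚ → a + (b + c) ≡ c
  +-cancel-left a b c e =
    trans (sym (ℚ.+-assoc a b c)) (trans (cong (_+ c) e) (ℚ.+-identityˡ c))

  *-cancel-left : ∀ a b c → a * b ≡ 1ℚ → a * (b * c) ≡ c
  *-cancel-left a b c e =
    trans (sym (ℚ.*-assoc a b c)) (trans (cong (_* c) e) (ℚ.*-identityˡ c))

infix  8 -ʳ_
infixr 7 _*ʳ_
infixr 6 _+ʳ_

-ʳ_ : ℝ → ℝ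
-ʳ x = record
  { below           = above x ∘ -_
  ; above           = below x ∘ -_
  ; below-inhabited = let q , a = X.above-inhabited in - q , subst (above x) (sym (neg-neg q)) a
  ; above-inhabited = let q , b = X.below-inhabited in - q , subst (below x) (sym (neg-neg q)) b
  ; below-rounded   = λ p → mk⇔
      (λ a → let q , q<-p , a′ = Equivalence.to (X.above-rounded (- p)) a in
             - q , subst (_< - q) (neg-neg p) (ℚ.neg-antimono-< q<-p)
                 , subst (above x) (sym (neg-neg q)) a′)
      (λ (q , p<q , a) →
             Equivalence.from (X.above-rounded (- p)) (- q , ℚ.neg-antimono-< p<q , a))
  ; above-rounded   = λ q → mk⇔
      (λ b → let p , -q<p , b′ = Equivalence.to (X.below-rounded (- q)) b in
             - p , subst (- p <_) (neg-neg q) (ℚ.neg-antimono-< -q<p)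
                 , subst (below x) (sym (neg-neg p)) b′)
      (λ (p , p<q , b) →
             Equivalence.from (X.below-rounded (- q)) (- p , ℚ.neg-antimono-< p<q , b))
  ; disjoint        = λ q (a , b) → X.disjoint (- q) (b , a)
  ; located         = λ p q p<q → Sum.swap (X.located (- q) (- p) (ℚ.neg-antimono-< p<q))
  }
  where module X = ℝ x

_+ʳ_ : ℚ → ℝ → ℝ
a +ʳ x = image (λ q → a + q) (λ q → - a + q)
  (ℚ.+-monoʳ-< a) (ℚ.+-monoʳ-< (- a))
  (λ q → +-cancel-left a (- a) q (ℚ.+-inverseʳ a))
  (λ q → +-cancel-left (- a) a q (ℚ.+-inverseˡ a)) x

_*ʳ_ : (c : ℚ) .{{_ : Positive c}} → ℝ → ℝ
c *ʳ x = image (λ q → c * q) (λ q → c⁻¹ * q)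
  (ℚ.*-monoʳ-<-pos c) (ℚ.*-monoʳ-<-pos c⁻¹ {{1/pos⇒pos c}})
  (λ q → *-cancel-left c c⁻¹ q (ℚ.*-inverseʳ c {{pos⇒nonZero c}}))
  (λ q → *-cancel-left c⁻¹ c q (ℚ.*-inverseˡ c {{pos⇒nonZero c}})) x
  where
  c⁻¹ : ℚ
  c⁻¹ = (1/ c) {{pos⇒nonZero c}}

-- For m ≥ 0 these say v ≤ ρ m and ρ m ≤ v; a product of the real ρ with
-- the (possibly zero) rational m is not needed.
_AtMost_Times_ : ℚ → ℝ → ℚ → Set
v AtMost ρ Times m = ∀ q → above ρ q → v ≤ q * m

_AtLeast_Times_ : ℚ → ℝ → ℚ → Set
v AtLeast ρ Times m = ∀ q → below ρ q → q * m ≤ v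

-- 2^(r-2), which is 1/2 for r = 1.
2^[_-2] : ℕ → ℚ
2^[ r -2] = + (2 ℕ.^ r) / 4

2^[-2]-positive : ∀ r → Positive 2^[ r -2]
2^[-2]-positive r = normalize-pos (2 ℕ.^ r) 4 {{_}} {{m^n≢0 2 r}}

infixr 7 2^[_-2]*ʳ_

2^[_-2]*ʳ_ : ℕ → ℝ → ℝ
2^[ r -2]*ʳ x = _*ʳ_ 2^[ r -2] {{2^[-2]-positive r}} x

------------------------------------------------------------------------
-- A model of computation: a while language on binary trees, in the style
-- of Jones (Computability and Complexity, 1997).  With shared trees every
-- step is a bounded number of pointer operations (there is no unit-cost
-- equality test or arithmetic), so step counts are polynomially related
-- to running times on random access and Turing machines.

infixr 5 _∙_

data Tree : Set where
  leaf : Tree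
  _∙_  : Tree → Tree → Tree

size : Tree → ℕ
size leaf    = 1
size (x ∙ y) = 1 ℕ.+ size x ℕ.+ size y

infixr 4 _⨾_

data Program : Set where
  leaf id hd tl : Program
  ⟨_,_⟩         : Program → Program → Program           -- pairs the outputs
  _⨾_           : Program → Program → Program           -- left program first
  cond          : Program → Program → Program → Program
  while         : Program → Program → Program

infix 3 _$_⇓[_]_

-- f $ x ⇓[ t ] y : on input x the program f halts after t steps with output y.
-- As a test, the tree leaf means false and every other tree means true.
data _$_⇓[_]_ : Program → Tree → ℕ → Tree → Set where
  leaf     : ∀ {x} → leaf $ x ⇓[ 1 ] leaf
  id       : ∀ {x} → id $ x ⇓[ 1 ] x
  hd-leaf  : hd $ leaf ⇓[ 1 ] leaf
  hd-∙     : ∀ {x y} → hd $ (x ∙ y) ⇓[ 1 ] x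
  tl-leaf  : tl $ leaf ⇓[ 1 ] leaf
  tl-∙     : ∀ {x y} → tl $ (x ∙ y) ⇓[ 1 ] y
  pair     : ∀ {f g x y z s t} →
             f $ x ⇓[ s ] y → g $ x ⇓[ t ] z →
             ⟨ f , g ⟩ $ x ⇓[ 1 ℕ.+ s ℕ.+ t ] (y ∙ z)
  seq      : ∀ {f g x y z s t} →
             f $ x ⇓[ s ] y → g $ y ⇓[ t ] z →
             (f ⨾ g) $ x ⇓[ 1 ℕ.+ s ℕ.+ t ] z
  cond-true  : ∀ {b f g x u v y s t} →
             b $ x ⇓[ s ] (u ∙ v) → f $ x ⇓[ t ] y →
             cond b f g $ x ⇓[ 1 ℕ.+ s ℕ.+ t ] y
  cond-false : ∀ {b f g x y s t} →
             b $ x ⇓[ s ] leaf → g $ x ⇓[ t ] y →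
             cond b f g $ x ⇓[ 1 ℕ.+ s ℕ.+ t ] y
  halt     : ∀ {b f x s} →
             b $ x ⇓[ s ] leaf →
             while b f $ x ⇓[ 1 ℕ.+ s ] x
  loop     : ∀ {b f x u v y z s t t′} →
             b $ x ⇓[ s ] (u ∙ v) → f $ x ⇓[ t ] y →
             while b f $ y ⇓[ t′ ] z →
             while b f $ x ⇓[ 1 ℕ.+ s ℕ.+ t ℕ.+ t′ ] z

encodeBool : Bool → Tree
encodeBool false = leaf
encodeBool true  = leaf ∙ leaf

encodeList : ∀ {A : Set} → (A → Tree) → List A → Tree
encodeList enc []       = leaf
encodeList enc (x ∷ xs) = enc x ∙ encodeList enc xs

encodeUnary : ℕ → Tree
encodeUnary zero    = leaf
encodeUnary (suc n) = leaf ∙ encodeUnary n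

encodeℕᵇ : ℕᵇ → Tree
encodeℕᵇ zero     = leaf
encodeℕᵇ 2[1+ b ] = encodeBool false ∙ encodeℕᵇ b
encodeℕᵇ 1+[2 b ] = encodeBool true  ∙ encodeℕᵇ b

encodeBinary : ℕ → Tree
encodeBinary n = encodeℕᵇ (fromℕ n)

-- The sign is dropped: all rationals in instances are non-negative.
encodeℚ : ℚ → Tree
encodeℚ q = encodeBinary ℤ.∣ ↥ q ∣ ∙ encodeBinary (↧ₙ q)

------------------------------------------------------------------------
-- Optimization problems and polynomial-time approximation

record Problem : Set₁ where
  field
    Instance       : Set
    Solution       : Instance → Set
    value          : (I : Instance) → Solution I → ℚ
    encodeInstance : Instance → Tree
    encodeSolution : (I : Instance) → Solution I → Tree

module _ (P : Problem) where
  open Problem P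

  -- The bound c · size ^ d is no restriction on polynomials, as sizes are positive.
  PolyTimeAlgorithm : ((I : Instance) → Solution I → Set) → Set
  PolyTimeAlgorithm Good =
    Σ[ f ∈ Program ] Σ[ c ∈ ℕ ] Σ[ d ∈ ℕ ] ∀ (I : Instance) →
    Σ[ s ∈ Solution I ] Σ[ t ∈ ℕ ]
      (f $ encodeInstance I ⇓[ t ] encodeSolution I s) ×
      t ℕ.≤ c ℕ.* size (encodeInstance I) ℕ.^ d ×
      Good I s

  IsMinimum IsMaximum : (I : Instance) → Solution I → Set
  IsMinimum I s* = ∀ s → value I s* ≤ value I s
  IsMaximum I s* = ∀ s → value I s ≤ value I s*

  MinApproximation : ℝ → Set
  MinApproximation ρ = PolyTimeAlgorithm λ I s →
    ∀ s* → IsMinimum I s* → value I s AtMost ρ Times value I s*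

  MaxApproximation : ℝ → Set
  MaxApproximation ρ = PolyTimeAlgorithm λ I s →
    ∀ s* → IsMaximum I s* → value I s AtLeast ρ Times value I s*

sumList : List ℚ → ℚ
sumList = foldr _+_ 0ℚ

------------------------------------------------------------------------
-- Two-machine scheduling, minimizing the sum of makespans over scenarios

record SM2Instance : Set where
  field
    n         : ℕ
    p         : Fin n → ℚ
    p≥0       : ∀ j → 0ℚ ≤ p j
    scenarios : List (Subset n)

  load : Subset n → ℚ
  load S = sum λ j → if lookup S j then p j else 0ℚ

  -- A is the set of jobs on machine 1.
  makespan : Subset n → Subset n → ℚ
  makespan A S = load (A ∩ S) ⊔ load (∁ A ∩ S)

  totalMakespan : Subset n → ℚ
  totalMakespan A = sumList (map (makespan A) scenarios)

  encode : Tree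
  encode = encodeList encodeℚ (tabulate p)
         ∙ encodeList (encodeList encodeBool ∘ toList) scenarios

SM2WithScenarioSizeAtMost : ℕ → Problem
SM2WithScenarioSizeAtMost r = record
  { Instance       = Σ[ I ∈ SM2Instance ]
                       All (λ S → ∣ S ∣ ℕ.≤ r) (SM2Instance.scenarios I)
  ; Solution       = λ (I , _) → Subset (SM2Instance.n I)
  ; value          = λ (I , _) → SM2Instance.totalMakespan I
  ; encodeInstance = λ (I , _) → SM2Instance.encode I
  ; encodeSolution = λ _ A → encodeList encodeBool (toList A)
  }

------------------------------------------------------------------------
-- Weighted Max Not-All-Equal r-Satisfiability

data Literal (n : ℕ) : Set where
  pos neg : Fin n → Literal n

evalLiteral : ∀ {n} → Vec Bool n → Literal n → Bool
evalLiteral α (pos x) = lookup α x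
evalLiteral α (neg x) = not (lookup α x)

record Clause (n r : ℕ) : Set where
  field
    literals : Vec (Literal n) r
    weight   : ℚ
    weight≥0 : 0ℚ ≤ weight

open Clause

Satisfied : ∀ {n r} → Vec Bool n → Clause n r → Set
Satisfied α C = Any (λ ℓ → evalLiteral α ℓ ≡ true)  (literals C)
              × Any (λ ℓ → evalLiteral α ℓ ≡ false) (literals C)

satisfied? : ∀ {n r} (α : Vec Bool n) (C : Clause n r) → Dec (Satisfied α C)
satisfied? α C = any? (λ ℓ → evalLiteral α ℓ ≟ᵇ true)  (literals C)
           ×-dec any? (λ ℓ → evalLiteral α ℓ ≟ᵇ false) (literals C)

record NaeInstance (r : ℕ) : Set where
  field
    n       : ℕ
    clauses : List (Clause n r)

  satisfiedWeight : Vec Bool n → ℚ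
  satisfiedWeight α =
    sumList (map (λ C → if does (satisfied? α C) then weight C else 0ℚ) clauses)

  encodeLiteral : Literal n → Tree
  encodeLiteral (pos x) = encodeBool true  ∙ encodeUnary (toℕ x)
  encodeLiteral (neg x) = encodeBool false ∙ encodeUnary (toℕ x)

  encodeClause : Clause n r → Tree
  encodeClause C = encodeList encodeLiteral (toList (literals C)) ∙ encodeℚ (weight C)

  -- Since a solution has length n, n is part of the input size; hence unary.
  encode : Tree
  encode = encodeUnary n ∙ encodeList encodeClause clauses

MaxNaeSat : ℕ → Problem
MaxNaeSat r = record
  { Instance       = NaeInstance r
  ; Solution       = λ I → Vec Bool (NaeInstance.n I)
  ; value          = NaeInstance.satisfiedWeight
  ; encodeInstance = NaeInstance.encode
  ; encodeSolution = λ _ α → encodeList encodeBool (toList α)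
  }

{-# OPTIONS --safe #-}

-- Let D be the product of the denominators of all processing times and x j = D p j.
-- Pad every scenario with jobs of weight 0 to exactly r positions, and give it one
-- clause for each of the 2 ^ r sign patterns ε, with the literal of position i
-- negated if ε i = -1 and with weight max(0, Σ ε i x i).  An assignment with loads
-- t and f (scaled by D) falsifies exactly the two clauses agreeing with it up to a
-- global sign, of total weight |t - f| = 2 max(t, f) - (t + f).  So satisfied weight
-- plus 2 D times the makespan is constant, and a loss of γ times the maximal
-- satisfied weight W costs at most γ W / 2 D.  A scenario contributes to W at most
-- Σ_ε max(0, Σ ε i x i) = 2^(r-1) E |U + V|, where U and V are the signed sums over
-- the jobs on either machine in an optimal solution; flipping the signs in V gives
-- E |U + V| = E max(|U|, |V|) ≤ max(t, f).  Hence γ W / 2 D is at most 2^(r-2) γ times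
-- the optimum.
--
-- Integral weights keep the reduction free of gcd computations: the denominator
-- in a clause weight is 1.

module Submission where

open import Defs
open import Data.Bool.Base using (Bool; true; false; not; if_then_else_; _∧_; _∨_)
open import Data.Bool.Properties using () renaming (_≟_ to _≟ᵇ_)
open import Data.Fin.Base using (Fin; zero; suc; toℕ)
open import Data.Fin.Subset using (Subset; _∩_; ∁; ∣_∣)
import Data.Integer.Base as ℤ
import Data.Integer.Properties as ℤ
open import Data.List.Base
  using (List; []; _∷_; _++_; foldl; foldr; length; map; replicate; reverse; tabulate)
open import Data.List.Properties
  using ( ++-is-foldr; length-++; length-map; length-tabulate; map-++; map-cong; map-∘
        ; reverse-foldl )
open import Data.List.Relation.Unary.All using (All; []; _∷_)
open import Data.Nat.Base
open import Data.Nat.Binary.Base using (ℕᵇ; zero; 2[1+_]; 1+[2_])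
import Data.Nat.Binary.Base as ℕᵇ
import Data.Nat.Binary.Properties as ℕᵇ
import Data.Nat.Coprimality as Coprimality
open import Data.Nat.ListAction using (sum)
open import Data.Nat.Properties
open import Data.Nat.Tactic.RingSolver using (solve-∀)
open import Data.Product.Base using (Σ-syntax; ∃-syntax; _×_; _,_; proj₁; proj₂)
open import Data.Rational.Base as ℚ
  using (ℚ; mkℚ; 0ℚ; 1ℚ; ↥_; ↧ₙ_; toℚᵘ)
import Data.Rational.Properties as ℚ
import Data.Rational.Solver as ℚ
import Data.Rational.Unnormalised.Base as ℚᵘ
import Data.Rational.Unnormalised.Properties as ℚᵘ
open import Data.Sum.Base using (inj₁; inj₂)
open import Data.Vec.Base using (Vec; []; _∷_; fromList; lookup; toList)
open import Data.Vec.Properties using (lookup-map; lookup-zipWith; toList∘fromList)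
open import Data.Vec.Relation.Unary.Any using (any?)
open import Function.Base using (_∘_)
open import Function.Bundles using (Equivalence)
open import Relation.Binary.PropositionalEquality
  using (_≡_; _≗_; refl; sym; trans; cong; cong₂; subst; subst₂; module ≡-Reasoning)
open import Relation.Nullary using (contradiction; does; yes; no)

open import Algebra.Properties.CommutativeMonoid.Sum ℚ.+-0-commutativeMonoid
  using (sum-cong-≗) renaming (sum to ∑)

-- Polynomial-time functions

-- Running time has to be proved for concrete while programs, so the reduction is assembled from
-- combinators that carry a program, a time bound and a bound on the size of the output. The
-- obstacle is iteration: a loop can blow up its accumulator exponentially although every step is
-- cheap, so each fold comes with a quantity that controls growth. The reduction exists twice, on
-- plain lists and numbers for the program and with typed clauses for the semantics; the two are
-- linked by an equality of codes. Taking the positive part of the signed sum for all 2 ^ r patterns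
-- splits an absolute value into two truncated differences, so no signed numbers occur. The bound on
-- W holds for the partition of any assignment and can therefore be read at the optimum. Since γ is
-- a cut, the guarantee is tested at rationals: each rational above 1 + 2^(r-2) γ comes from a
-- rational g above γ, and the estimate is done with g. An optimal partition must also be shown to
-- give a maximum assignment, because the given algorithm is compared with maxima only.

infixr 6 _⊗_

-- `nat` and `bin` denote the same set and differ only in their codes, unary and binary; the choice
-- decides what counts as polynomial.
data Ty : Set where
  bool nat bin : Ty
  _⊗_          : Ty → Ty → Ty
  list         : Ty → Ty

⟦_⟧ : Ty → Set
⟦ bool ⟧   = Bool
⟦ nat ⟧    = ℕ
⟦ bin ⟧    = ℕ
⟦ σ ⊗ τ ⟧  = ⟦ σ ⟧ × ⟦ τ ⟧
⟦ list τ ⟧ = List ⟦ τ ⟧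

enc : ∀ τ → ⟦ τ ⟧ → Tree
enc bool           = encodeBool
enc nat            = encodeUnary
enc bin            = encodeBinary
enc (σ ⊗ τ) (x , y) = enc σ x ∙ enc τ y
enc (list τ)       = encodeList (enc τ)

∣_∋_∣ : ∀ τ → ⟦ τ ⟧ → ℕ
∣ τ ∋ x ∣ = size (enc τ x)

1≤size : ∀ t → 1 ≤ size t
1≤size leaf    = s≤s z≤n
1≤size (_ ∙ _) = s≤s z≤n

-- Polynomial bounds in the size of the input

record Bounded (Γ : Ty) (g : ⟦ Γ ⟧ → ℕ) : Set where
  constructor bounded
  field
    coefficient degree : ℕ
    bound : ∀ γ → g γ ≤ coefficient * ∣ Γ ∋ γ ∣ ^ degree

module _ {Γ : Ty} where

  private
    1≤^ : ∀ d γ → 1 ≤ ∣ Γ ∋ γ ∣ ^ d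
    1≤^ d γ = subst (_≤ ∣ Γ ∋ γ ∣ ^ d) (^-zeroˡ d) (^-monoˡ-≤ d (1≤size (enc Γ γ)))

  bounded-≤ : ∀ {g h} → (∀ γ → g γ ≤ h γ) → Bounded Γ h → Bounded Γ g
  bounded-≤ g≤h (bounded c d p) = bounded c d λ γ → ≤-trans (g≤h γ) (p γ)

  bounded-const : ∀ n → Bounded Γ (λ _ → n)
  bounded-const n = bounded n 0 λ _ → ≤-reflexive (sym (*-identityʳ n))

  bounded-size : Bounded Γ ∣ Γ ∋_∣
  bounded-size = bounded 1 1 λ γ →
    ≤-reflexive (sym (trans (*-identityˡ _) (*-identityʳ _)))

  bounded-* : ∀ {g h} → Bounded Γ g → Bounded Γ h → Bounded Γ (λ γ → g γ * h γ)
  bounded-* {g} {h} (bounded c d p) (bounded c′ d′ p′) = bounded (c * c′) (d + d′) λ γ →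
    let s = ∣ Γ ∋ γ ∣ in begin
    g γ * h γ                     ≤⟨ *-mono-≤ (p γ) (p′ γ) ⟩
    (c * s ^ d) * (c′ * s ^ d′)   ≡⟨ interchange c (s ^ d) c′ (s ^ d′) ⟩
    (c * c′) * (s ^ d * s ^ d′)   ≡⟨ cong (c * c′ *_) (^-distribˡ-+-* s d d′) ⟨
    c * c′ * s ^ (d + d′)         ∎
    where
    open ≤-Reasoning
    interchange : ∀ a b x y → (a * b) * (x * y) ≡ (a * x) * (b * y)
    interchange = solve-∀

  -- Sizes are at least 1, so either power is at most the product of both; adding the degrees avoids
  -- comparing them.
  bounded-+ : ∀ {g h} → Bounded Γ g → Bounded Γ h → Bounded Γ (λ γ → g γ + h γ)
  bounded-+ {g} {h} (bounded c d p) (bounded c′ d′ p′) = bounded (c + c′) (d + d′) λ γ →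
    let s = ∣ Γ ∋ γ ∣ in begin
    g γ + h γ                                   ≤⟨ +-mono-≤ (p γ) (p′ γ) ⟩
    c * s ^ d + c′ * s ^ d′                     ≤⟨ +-mono-≤
      (*-monoʳ-≤ c (m≤m*n (s ^ d) (s ^ d′) {{>-nonZero (1≤^ d′ γ)}}))
      (*-monoʳ-≤ c′ (m≤n*m (s ^ d′) (s ^ d) {{>-nonZero (1≤^ d γ)}})) ⟩
    c * (s ^ d * s ^ d′) + c′ * (s ^ d * s ^ d′) ≡⟨ *-distribʳ-+ (s ^ d * s ^ d′) c c′ ⟨
    (c + c′) * (s ^ d * s ^ d′)                 ≡⟨ cong ((c + c′) *_) (^-distribˡ-+-* s d d′) ⟨
    (c + c′) * s ^ (d + d′)                     ∎
    where open ≤-Reasoning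

  bounded-^ : ∀ {g} d → Bounded Γ g → Bounded Γ (λ γ → g γ ^ d)
  bounded-^ zero    b = bounded-const 1
  bounded-^ (suc d) b = bounded-* b (bounded-^ d b)

  bounded-∘ : ∀ {Δ h f} → Bounded Δ h → Bounded Γ (∣ Δ ∋_∣ ∘ f) → Bounded Γ (h ∘ f)
  bounded-∘ {Δ} {h} {f} (bounded c d p) b =
    bounded-≤ (p ∘ f) (bounded-* (bounded-const c) (bounded-^ d b))

-- The size bound does not follow from the time bound: trees are shared, and a loop around
-- `⟨ id , id ⟩` doubles the output at constant cost per round. Composition needs both bounds.
record PolyTime (Γ τ : Ty) (f : ⟦ Γ ⟧ → ⟦ τ ⟧) : Set where
  field
    program      : Program
    time         : ⟦ Γ ⟧ → ℕ
    run          : ∀ γ → ∃[ t ] (program $ enc Γ γ ⇓[ t ] enc τ (f γ)) × t ≤ time γ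
    time-bounded : Bounded Γ time
    size-bounded : Bounded Γ (λ γ → ∣ τ ∋ f γ ∣)

open PolyTime

quoteᵗ : Tree → Program
quoteᵗ leaf    = leaf
quoteᵗ (x ∙ y) = ⟨ quoteᵗ x , quoteᵗ y ⟩

run-quoteᵗ : ∀ x {y} → quoteᵗ x $ y ⇓[ size x ] x
run-quoteᵗ leaf    = leaf
run-quoteᵗ (x ∙ y) = pair (run-quoteᵗ x) (run-quoteᵗ y)

truth : Tree → Bool
truth leaf    = false
truth (_ ∙ _) = true

module _ {Γ : Ty} where

  -- A program sees codes only, so values of different types with equal codes are interchangeable at
  -- no cost: pairs and nonempty lists, numbers and digit lists.
  recode : ∀ {σ τ f g} → PolyTime Γ σ f → (∀ γ → enc σ (f γ) ≡ enc τ (g γ)) →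
           PolyTime Γ τ g
  recode F eq = record
    { program      = program F
    ; time         = time F
    ; run          = λ γ → let t , r , b = run F γ in
                     t , subst (program F $ enc Γ γ ⇓[ t ]_) (eq γ) r , b
    ; time-bounded = time-bounded F
    ; size-bounded = bounded-≤ (λ γ → ≤-reflexive (cong size (sym (eq γ)))) (size-bounded F)
    }

  ext : ∀ {τ f g} → PolyTime Γ τ f → f ≗ g → PolyTime Γ τ g
  ext {τ} F eq = recode F (cong (enc τ) ∘ eq)

  idᵖ : PolyTime Γ Γ (λ γ → γ)
  idᵖ = record
    { program = id ; time = λ _ → 1 ; run = λ _ → 1 , id , ≤-refl
    ; time-bounded = bounded-const 1 ; size-bounded = bounded-size }

  constᵖ : ∀ {τ} (x : ⟦ τ ⟧) → PolyTime Γ τ (λ _ → x)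
  constᵖ {τ} x = record
    { program = quoteᵗ (enc τ x) ; time = λ _ → ∣ τ ∋ x ∣
    ; run = λ _ → _ , run-quoteᵗ (enc τ x) , ≤-refl
    ; time-bounded = bounded-const _ ; size-bounded = bounded-const _ }

  pairᵖ : ∀ {σ τ f g} → PolyTime Γ σ f → PolyTime Γ τ g →
          PolyTime Γ (σ ⊗ τ) (λ γ → f γ , g γ)
  pairᵖ F G = record
    { program      = ⟨ program F , program G ⟩
    ; time         = λ γ → 1 + time F γ + time G γ
    ; run          = λ γ → let s , p , a = run F γ ; t , q , b = run G γ in
                     _ , pair p q , s≤s (+-mono-≤ a b)
    ; time-bounded = bounded-+ (bounded-+ (bounded-const 1) (time-bounded F)) (time-bounded G)
    ; size-bounded = bounded-+ (bounded-+ (bounded-const 1) (size-bounded F)) (size-bounded G)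
    }

  applyᵖ : ∀ {σ τ f g} → PolyTime σ τ g → PolyTime Γ σ f → PolyTime Γ τ (g ∘ f)
  applyᵖ {f = f} G F = record
    { program      = program F ⨾ program G
    ; time         = λ γ → 1 + time F γ + time G (f γ)
    ; run          = λ γ → let s , p , a = run F γ ; t , q , b = run G (f γ) in
                     _ , seq p q , s≤s (+-mono-≤ a b)
    ; time-bounded = bounded-+ (bounded-+ (bounded-const 1) (time-bounded F))
                               (bounded-∘ (time-bounded G) (size-bounded F))
    ; size-bounded = bounded-∘ (size-bounded G) (size-bounded F)
    }

  -- The test value may have any type, since a program only distinguishes `leaf` from other trees;
  -- numbers can thus be tested for zero directly.
  ifᵖ : ∀ {σ τ t f g} {b : ⟦ Γ ⟧ → Bool} →
        PolyTime Γ σ t → (∀ γ → truth (enc σ (t γ)) ≡ b γ) →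
        PolyTime Γ τ f → PolyTime Γ τ g →
        PolyTime Γ τ (λ γ → if b γ then f γ else g γ)
  ifᵖ {σ} {τ} {t} {f} {g} {b} T eq F G = record
    { program      = cond (program T) (program F) (program G)
    ; time         = λ γ → 1 + time T γ + (time F γ + time G γ)
    ; run          = λ γ → go γ (enc σ (t γ)) (eq γ) (run T γ)
    ; time-bounded = bounded-+ (bounded-+ (bounded-const 1) (time-bounded T))
                               (bounded-+ (time-bounded F) (time-bounded G))
    ; size-bounded = bounded-≤ (λ γ → branch γ (b γ))
                               (bounded-+ (size-bounded F) (size-bounded G))
    }
    where
    branch : ∀ γ b → ∣ τ ∋ if b then f γ else g γ ∣ ≤ ∣ τ ∋ f γ ∣ + ∣ τ ∋ g γ ∣
    branch γ true  = m≤m+n _ _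
    branch γ false = m≤n+m _ _
    go : ∀ γ x {b} → truth x ≡ b →
         (∃[ s ] (program T $ enc Γ γ ⇓[ s ] x) × s ≤ time T γ) →
         ∃[ s ] (cond (program T) (program F) (program G) $ enc Γ γ
                   ⇓[ s ] enc τ (if b then f γ else g γ))
                × s ≤ 1 + time T γ + (time F γ + time G γ)
    go γ leaf refl (s , p , a) = let s′ , q , a′ = run G γ in
      _ , cond-false p q , s≤s (+-mono-≤ a (≤-trans a′ (m≤n+m _ _)))
    go γ (_ ∙ _) refl (s , p , a) = let s′ , q , a′ = run F γ in
      _ , cond-true p q , s≤s (+-mono-≤ a (≤-trans a′ (m≤m+n _ _)))

  fstᵖ : ∀ {σ τ f} → PolyTime Γ (σ ⊗ τ) f → PolyTime Γ σ (proj₁ ∘ f)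
  fstᵖ = applyᵖ record
    { program = hd ; time = λ _ → 1 ; run = λ _ → 1 , hd-∙ , ≤-refl
    ; time-bounded = bounded-const 1
    ; size-bounded = bounded-≤ (λ _ → ≤-trans (m≤n+m _ 1) (m≤m+n _ _)) bounded-size }

  sndᵖ : ∀ {σ τ f} → PolyTime Γ (σ ⊗ τ) f → PolyTime Γ τ (proj₂ ∘ f)
  sndᵖ = applyᵖ record
    { program = tl ; time = λ _ → 1 ; run = λ _ → 1 , tl-∙ , ≤-refl
    ; time-bounded = bounded-const 1
    ; size-bounded = bounded-≤ (λ _ → m≤n+m _ _) bounded-size }

  infixr 5 _∷ᵖ_

  _∷ᵖ_ : ∀ {τ f g} → PolyTime Γ τ f → PolyTime Γ (list τ) g →
         PolyTime Γ (list τ) (λ γ → f γ ∷ g γ)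
  F ∷ᵖ G = recode (pairᵖ F G) λ _ → refl

-- Lists and loops over them

tail : ∀ {A : Set} → List A → List A
tail []       = []
tail (_ ∷ xs) = xs

headOr : ∀ {A : Set} → A → List A → A
headOr d []      = d
headOr d (x ∷ _) = x

module _ {Γ : Ty} where

  tailᵖ : ∀ {τ f} → PolyTime Γ (list τ) f → PolyTime Γ (list τ) (tail ∘ f)
  tailᵖ {τ} = applyᵖ {g = tail} record
    { program = tl ; time = λ _ → 1
    ; run = λ { [] → 1 , tl-leaf , ≤-refl ; (_ ∷ _) → 1 , tl-∙ , ≤-refl }
    ; time-bounded = bounded-const 1
    ; size-bounded = bounded-≤ (λ { [] → ≤-refl ; (_ ∷ _) → m≤n+m _ _ }) bounded-size }

  -- hd returns leaf on the empty list, so the default must be encoded by leaf.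
  headOrᵖ : ∀ {τ d f} → enc τ d ≡ leaf → PolyTime Γ (list τ) f → PolyTime Γ τ (headOr d ∘ f)
  headOrᵖ {τ} {d} eq = applyᵖ {g = headOr d} record
    { program = hd ; time = λ _ → 1
    ; run = λ { [] → 1 , subst (hd $ leaf ⇓[ 1 ]_) (sym eq) hd-leaf , ≤-refl
              ; (_ ∷ _) → 1 , hd-∙ , ≤-refl }
    ; time-bounded = bounded-const 1
    ; size-bounded = bounded-≤ (λ { [] → ≤-reflexive (cong size eq)
                                  ; (_ ∷ _) → ≤-trans (m≤n+m _ 1) (m≤m+n _ _) }) bounded-size }

  -- The potential Φ bounds the size of the accumulator b when the elements xs
  -- are still to be processed, and it must not increase.
  foldlᵖ : ∀ {A B l z} {step : ⟦ Γ ⊗ A ⊗ B ⟧ → ⟦ B ⟧} →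
    PolyTime Γ (list A) l → PolyTime Γ B z → PolyTime (Γ ⊗ A ⊗ B) B step →
    (Φ : ⟦ Γ ⟧ → List ⟦ A ⟧ → ⟦ B ⟧ → ℕ) →
    (∀ γ xs b → ∣ B ∋ b ∣ ≤ Φ γ xs b) →
    (∀ γ x xs b → Φ γ xs (step (γ , x , b)) ≤ Φ γ (x ∷ xs) b) →
    Bounded Γ (λ γ → Φ γ (l γ) (z γ)) →
    PolyTime Γ B (λ γ → foldl (λ b x → step (γ , x , b)) (z γ) (l γ))
  foldlᵖ {A} {B} {l} {z} {step} L Z S Φ size≤Φ Φ-step Φ-bounded = record
    -- The loop state is `γ ∙ (xs ∙ b)` with remaining elements `xs` and accumulator `b`; the loop
    -- ends when the code of `xs` is `leaf`.
    { program      = ⟨ id , ⟨ program L , program Z ⟩ ⟩ ⨾ while (tl ⨾ hd) body ⨾ (tl ⨾ tl)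
    ; time         = total
    ; run          = λ γ →
        let t , p , a = run L γ
            s , q , b = run Z γ
            u , r , c = loops γ (l γ) (z γ) ≤-refl ≤-refl in
        _ , seq (pair id (pair p q)) (seq r (seq tl-∙ tl-∙))
          , s≤s (+-mono-≤ (s≤s (s≤s (s≤s (+-mono-≤ a b)))) (s≤s (+-monoˡ-≤ 3 c)))
    ; time-bounded = bounded-+ (bounded-+ (bounded-const 4)
                       (bounded-+ (time-bounded L) (time-bounded Z)))
                       (bounded-+ (bounded-const 1) (bounded-+ (bounded-+
                         (bounded-* (size-bounded L) iteration-bounded) (bounded-const 5))
                         (bounded-const 3)))
    ; size-bounded = bounded-≤ (λ γ → final γ (l γ) (z γ)) Φ-bounded
    }
    where
    module S = Bounded (time-bounded S)
    body : Program
    body = ⟨ hd , ⟨ tl ⨾ hd ⨾ tl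
                  , ⟨ hd , ⟨ tl ⨾ hd ⨾ hd , tl ⨾ tl ⟩ ⟩ ⨾ program S ⟩ ⟩
    M iteration total : ⟦ Γ ⟧ → ℕ
    M γ = Φ γ (l γ) (z γ)
    -- Because the potential never increases, `M γ` bounds every accumulator, and the same bound
    -- serves for all rounds. The 24 counts the steps of the test and the body outside `program S`.
    iteration γ = 24 + S.coefficient * (2 + ∣ Γ ∋ γ ∣ + (∣ list A ∋ l γ ∣ + M γ)) ^ S.degree
    total γ = 4 + (time L γ + time Z γ)
            + (1 + (∣ list A ∋ l γ ∣ * iteration γ + 5 + 3))
    iteration-bounded : Bounded Γ iteration
    iteration-bounded = bounded-+ (bounded-const 24) (bounded-* (bounded-const S.coefficient)
      (bounded-^ S.degree (bounded-+ (bounded-+ (bounded-const 2) bounded-size)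
                                     (bounded-+ (size-bounded L) Φ-bounded))))
    final : ∀ γ xs b → ∣ B ∋ foldl (λ b x → step (γ , x , b)) b xs ∣ ≤ Φ γ xs b
    final γ []       b = size≤Φ γ [] b
    final γ (x ∷ xs) b = ≤-trans (final γ xs _) (Φ-step γ x xs b)

    input-size : ∀ g a as b {m n} → 1 + a + as ≤ m → b ≤ n →
                 1 + g + (1 + a + b) ≤ 2 + g + (m + n)
    input-size g a as b {m} {n} p q = begin
      1 + g + (1 + a + b) ≤⟨ +-monoʳ-≤ (1 + g) (+-mono-≤ (≤-trans (m≤m+n (1 + a) as) p) q) ⟩
      1 + g + (m + n)     ≤⟨ n≤1+n _ ⟩
      2 + g + (m + n)     ∎
      where open ≤-Reasoning

    loops : ∀ γ xs b → ∣ list A ∋ xs ∣ ≤ ∣ list A ∋ l γ ∣ → Φ γ xs b ≤ M γ →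
      ∃[ t ] (while (tl ⨾ hd) body $ enc Γ γ ∙ (enc (list A) xs ∙ enc B b) ⇓[ t ]
              enc Γ γ ∙ (leaf ∙ enc B (foldl (λ b x → step (γ , x , b)) b xs)))
             × t ≤ ∣ list A ∋ xs ∣ * iteration γ + 5
    loops γ [] b _ _ = _ , halt (seq tl-∙ hd-∙) , ≤-trans (n≤1+n 4) (m≤n+m 5 (∣ list A ∋ [] ∣ * iteration γ))
    loops γ (x ∷ xs) b xs≤ Φ≤ =
      let s , p , a = run S (γ , x , b)
          t , q , c = loops γ xs (step (γ , x , b))
                        (≤-trans (m≤n+m _ (1 + ∣ A ∋ x ∣)) xs≤)
                        (≤-trans (Φ-step γ x xs b) Φ≤) in
      _ , loop (seq tl-∙ hd-∙)
               (pair hd-∙ (pair (seq tl-∙ (seq hd-∙ tl-∙))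
                 (seq (pair hd-∙ (pair (seq tl-∙ (seq hd-∙ hd-∙)) (seq tl-∙ tl-∙))) p)))
               q
        , (begin
          (24 + s) + t                           ≤⟨ +-mono-≤ {_} {iteration γ} (+-monoʳ-≤ 24 (begin
            s                                      ≤⟨ a ⟩
            time S (γ , x , b)                     ≤⟨ S.bound (γ , x , b) ⟩
            _                                      ≤⟨ *-monoʳ-≤ S.coefficient (^-monoˡ-≤ S.degree
              (input-size ∣ Γ ∋ γ ∣ ∣ A ∋ x ∣ ∣ list A ∋ xs ∣ ∣ B ∋ b ∣
                 xs≤ (≤-trans (size≤Φ γ (x ∷ xs) b) Φ≤))) ⟩
            _ ∎)) c ⟩
          iteration γ + (∣ list A ∋ xs ∣ * iteration γ + 5) ≡⟨ +-assoc (iteration γ) _ 5 ⟨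
          (1 + ∣ list A ∋ xs ∣) * iteration γ + 5 ≤⟨ +-monoˡ-≤ 5 (*-monoˡ-≤ (iteration γ)
             (s≤s (m≤n+m ∣ list A ∋ xs ∣ ∣ A ∋ x ∣))) ⟩
          ∣ list A ∋ x ∷ xs ∣ * iteration γ + 5  ∎)
      where open ≤-Reasoning

module _ {Γ A B : Ty} where

  envᵖ : PolyTime (Γ ⊗ A ⊗ B) Γ proj₁
  envᵖ = fstᵖ idᵖ

  eltᵖ : PolyTime (Γ ⊗ A ⊗ B) A (proj₁ ∘ proj₂)
  eltᵖ = fstᵖ (sndᵖ idᵖ)

  accᵖ : PolyTime (Γ ⊗ A ⊗ B) B (proj₂ ∘ proj₂)
  accᵖ = sndᵖ (sndᵖ idᵖ)

  -- The potential is the measure plus all increases still to come, which works because `K` does not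
  -- see the accumulator. A measure linearly related to the size is allowed, since numbers of equal
  -- digit count can have codes of different size.
  foldl-additiveᵖ : ∀ {l z} {step : ⟦ Γ ⊗ A ⊗ B ⟧ → ⟦ B ⟧} →
    PolyTime Γ (list A) l → PolyTime Γ B z → PolyTime (Γ ⊗ A ⊗ B) B step →
    (μ : ⟦ B ⟧ → ℕ) (c : ℕ) (K : ⟦ Γ ⊗ A ⟧ → ℕ) →
    (∀ b → μ b ≤ ∣ B ∋ b ∣) → (∀ b → ∣ B ∋ b ∣ ≤ c * suc (μ b)) →
    Bounded (Γ ⊗ A) K → (∀ γ x b → μ (step (γ , x , b)) ≤ K (γ , x) + μ b) →
    PolyTime Γ B (λ γ → foldl (λ b x → step (γ , x , b)) (z γ) (l γ))
  foldl-additiveᵖ {l} {z} {step} L Z S μ c K μ≤size size≤μ K-bounded μ-step =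
    foldlᵖ L Z S Φ
      (λ γ xs b → ≤-trans (size≤μ b) (*-monoʳ-≤ c (s≤s (m≤m+n (μ b) (ΣK γ xs)))))
      (λ γ x xs b → *-monoʳ-≤ c (s≤s (begin
        μ (step (γ , x , b)) + ΣK γ xs  ≤⟨ +-monoˡ-≤ (ΣK γ xs) (μ-step γ x b) ⟩
        K (γ , x) + μ b + ΣK γ xs       ≡⟨ cong (_+ ΣK γ xs) (+-comm (K (γ , x)) (μ b)) ⟩
        μ b + K (γ , x) + ΣK γ xs       ≡⟨ +-assoc (μ b) _ _ ⟩
        μ b + (K (γ , x) + ΣK γ xs)     ∎)))
      (bounded-* (bounded-const c) (bounded-+ (bounded-const 1) (bounded-+
        (bounded-≤ (λ γ → μ≤size (z γ)) (size-bounded Z))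
        (bounded-≤ (λ γ → ΣK≤ γ (l γ) ≤-refl)
          (bounded-* (size-bounded L) (bounded-* (bounded-const C)
            (bounded-^ D (bounded-+ bounded-size (size-bounded L)))))))))
    where
    open ≤-Reasoning
    open Bounded K-bounded renaming (coefficient to C; degree to D; bound to K≤)
    ΣK : ⟦ Γ ⟧ → List ⟦ A ⟧ → ℕ
    ΣK γ []       = 0
    ΣK γ (x ∷ xs) = K (γ , x) + ΣK γ xs
    Φ : ⟦ Γ ⟧ → List ⟦ A ⟧ → ⟦ B ⟧ → ℕ
    Φ γ xs b = c * suc (μ b + ΣK γ xs)
    ΣK≤ : ∀ γ xs {N} → ∣ list A ∋ xs ∣ ≤ N →
          ΣK γ xs ≤ ∣ list A ∋ xs ∣ * (C * (∣ Γ ∋ γ ∣ + N) ^ D)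
    ΣK≤ γ []       _ = z≤n
    ΣK≤ γ (x ∷ xs) {N} xs≤N = begin
      K (γ , x) + ΣK γ xs                ≤⟨ +-mono-≤
        (≤-trans (K≤ (γ , x)) (*-monoʳ-≤ C (^-monoˡ-≤ D (begin
          1 + ∣ Γ ∋ γ ∣ + ∣ A ∋ x ∣     ≡⟨ +-suc ∣ Γ ∋ γ ∣ ∣ A ∋ x ∣ ⟨
          ∣ Γ ∋ γ ∣ + (1 + ∣ A ∋ x ∣)   ≤⟨ +-monoʳ-≤ ∣ Γ ∋ γ ∣ (≤-trans (m≤m+n _ ∣ list A ∋ xs ∣) xs≤N) ⟩
          ∣ Γ ∋ γ ∣ + N ∎))))
        (ΣK≤ γ xs (≤-trans (m≤n+m _ (1 + ∣ A ∋ x ∣)) xs≤N)) ⟩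
      (1 + ∣ list A ∋ xs ∣) * (C * (∣ Γ ∋ γ ∣ + N) ^ D) ≤⟨
        *-monoˡ-≤ (C * (∣ Γ ∋ γ ∣ + N) ^ D) (s≤s (m≤n+m ∣ list A ∋ xs ∣ ∣ A ∋ x ∣)) ⟩
      ∣ list A ∋ x ∷ xs ∣ * (C * (∣ Γ ∋ γ ∣ + N) ^ D) ∎

reverseᵖ : ∀ {Γ A l} → PolyTime Γ (list A) l → PolyTime Γ (list A) (reverse ∘ l)
reverseᵖ {Γ} {A} L = foldl-additiveᵖ L (constᵖ []) (eltᵖ ∷ᵖ accᵖ)
  ∣ list A ∋_∣ 1 (λ (γ , x) → 1 + ∣ A ∋ x ∣) (λ _ → ≤-refl)
  (λ b → ≤-trans (n≤1+n _) (≤-reflexive (sym (*-identityˡ _))))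
  (bounded-+ (bounded-const 1) (size-bounded (sndᵖ idᵖ))) (λ _ _ _ → ≤-refl)

foldr-additiveᵖ : ∀ {Γ A B l z} {step : ⟦ Γ ⊗ A ⊗ B ⟧ → ⟦ B ⟧} →
  PolyTime Γ (list A) l → PolyTime Γ B z → PolyTime (Γ ⊗ A ⊗ B) B step →
  (μ : ⟦ B ⟧ → ℕ) (c : ℕ) (K : ⟦ Γ ⊗ A ⟧ → ℕ) →
  (∀ b → μ b ≤ ∣ B ∋ b ∣) → (∀ b → ∣ B ∋ b ∣ ≤ c * suc (μ b)) →
  Bounded (Γ ⊗ A) K → (∀ γ x b → μ (step (γ , x , b)) ≤ K (γ , x) + μ b) →
  PolyTime Γ B (λ γ → foldr (λ x b → step (γ , x , b)) (z γ) (l γ))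
foldr-additiveᵖ {l = l} {z} {step} L Z S μ c K p q r s =
  ext (foldl-additiveᵖ (reverseᵖ L) Z S μ c K p q r s)
      (λ γ → reverse-foldl (λ b x → step (γ , x , b)) (z γ) (l γ))

infixr 5 _++ᵖ_

_++ᵖ_ : ∀ {Γ A f g} → PolyTime Γ (list A) f → PolyTime Γ (list A) g →
        PolyTime Γ (list A) (λ γ → f γ ++ g γ)
_++ᵖ_ {Γ} {A} {f} {g} F G = ext
  (foldr-additiveᵖ F G (eltᵖ ∷ᵖ accᵖ)
    ∣ list A ∋_∣ 1 (λ (γ , x) → 1 + ∣ A ∋ x ∣) (λ _ → ≤-refl)
    (λ b → ≤-trans (n≤1+n _) (≤-reflexive (sym (*-identityˡ _))))
    (bounded-+ (bounded-const 1) (size-bounded (sndᵖ idᵖ))) (λ _ _ _ → ≤-refl))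
  (λ γ → sym (++-is-foldr (f γ) (g γ)))

-- The digits of bijective binary notation, least significant first, where true
-- stands for the digit 1 and false for the digit 2; this is the encoding of ℕᵇ.

digitsValue : List Bool → ℕ
digitsValue []           = 0
digitsValue (true  ∷ ds) = 1 + 2 * digitsValue ds
digitsValue (false ∷ ds) = 2 + 2 * digitsValue ds

private
  digitsᵇ : ℕᵇ → List Bool
  digitsᵇ zero     = []
  digitsᵇ 2[1+ n ] = false ∷ digitsᵇ n
  digitsᵇ 1+[2 n ] = true ∷ digitsᵇ n

  value-digitsᵇ : ∀ n → digitsValue (digitsᵇ n) ≡ ℕᵇ.toℕ n
  value-digitsᵇ zero     = refl
  value-digitsᵇ 2[1+ n ] = trans (cong (λ m → 2 + 2 * m) (value-digitsᵇ n))
                                 (sym (*-suc 2 (ℕᵇ.toℕ n)))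
  value-digitsᵇ 1+[2 n ] = cong (λ m → 1 + 2 * m) (value-digitsᵇ n)

  encode-digitsᵇ : ∀ n → encodeList encodeBool (digitsᵇ n) ≡ encodeℕᵇ n
  encode-digitsᵇ zero     = refl
  encode-digitsᵇ 2[1+ n ] = cong (leaf ∙_) (encode-digitsᵇ n)
  encode-digitsᵇ 1+[2 n ] = cong ((leaf ∙ leaf) ∙_) (encode-digitsᵇ n)

  fromDigits : List Bool → ℕᵇ
  fromDigits []           = zero
  fromDigits (true  ∷ ds) = 1+[2 fromDigits ds ]
  fromDigits (false ∷ ds) = 2[1+ fromDigits ds ]

  digitsᵇ-fromDigits : ∀ ds → digitsᵇ (fromDigits ds) ≡ ds
  digitsᵇ-fromDigits []           = refl
  digitsᵇ-fromDigits (true  ∷ ds) = cong (true ∷_) (digitsᵇ-fromDigits ds)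
  digitsᵇ-fromDigits (false ∷ ds) = cong (false ∷_) (digitsᵇ-fromDigits ds)

digits : ℕ → List Bool
digits n = digitsᵇ (ℕᵇ.fromℕ n)

value-digits : ∀ n → digitsValue (digits n) ≡ n
value-digits n = trans (value-digitsᵇ (ℕᵇ.fromℕ n)) (ℕᵇ.toℕ-fromℕ n)

-- Bijective notation has no redundant digit strings, so programs may build digit lists freely
-- without stripping leading zeros.
digits-value : ∀ ds → digits (digitsValue ds) ≡ ds
digits-value ds = begin
  digitsᵇ (ℕᵇ.fromℕ (digitsValue ds))                        ≡⟨ cong (digitsᵇ ∘ ℕᵇ.fromℕ ∘ digitsValue) (digitsᵇ-fromDigits ds) ⟨
  digitsᵇ (ℕᵇ.fromℕ (digitsValue (digitsᵇ (fromDigits ds)))) ≡⟨ cong (digitsᵇ ∘ ℕᵇ.fromℕ) (value-digitsᵇ (fromDigits ds)) ⟩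
  digitsᵇ (ℕᵇ.fromℕ (ℕᵇ.toℕ (fromDigits ds)))             ≡⟨ cong digitsᵇ (ℕᵇ.fromℕ-toℕ (fromDigits ds)) ⟩
  digitsᵇ (fromDigits ds)                           ≡⟨ digitsᵇ-fromDigits ds ⟩
  ds                                                ∎
  where open ≡-Reasoning

encode-digits : ∀ n → enc (list bool) (digits n) ≡ enc bin n
encode-digits n = encode-digitsᵇ (ℕᵇ.fromℕ n)

encode-value : ∀ ds → enc (list bool) ds ≡ enc bin (digitsValue ds)
encode-value ds = trans (cong (enc (list bool)) (sym (digits-value ds))) (encode-digits (digitsValue ds))

-- This is the integer part of log2 (n + 1), as the two estimates by powers of 2 below show.
digitCount : ℕ → ℕ
digitCount n = length (digits n)

digitCount-odd : ∀ n → digitCount (1 + 2 * n) ≡ suc (digitCount n)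
digitCount-odd n = trans (cong (λ m → digitCount (1 + 2 * m)) (sym (value-digits n)))
                         (cong length (digits-value (true ∷ digits n)))

digitCount-even : ∀ n → digitCount (2 + 2 * n) ≡ suc (digitCount n)
digitCount-even n = trans (cong (λ m → digitCount (2 + 2 * m)) (sym (value-digits n)))
                          (cong length (digits-value (false ∷ digits n)))

private
  -- Strings of k digits range from all ones, with value 2^k - 1, to all twos, with value 2^(k+1) -
  -- 2; this gives both estimates.
  2^length≤ : ∀ ds → 2 ^ length ds ≤ suc (digitsValue ds)
  2^length≤ []           = ≤-refl
  2^length≤ (true ∷ ds)  = ≤-trans (*-monoʳ-≤ 2 (2^length≤ ds)) (≤-reflexive (*-suc 2 (digitsValue ds)))
  2^length≤ (false ∷ ds) = ≤-trans (*-monoʳ-≤ 2 (2^length≤ ds))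
                             (≤-trans (≤-reflexive (*-suc 2 (digitsValue ds))) (n≤1+n _))

  <2^length : ∀ ds → suc (digitsValue ds) < 2 ^ suc (length ds)
  <2^length []           = s≤s (s≤s z≤n)
  <2^length (true ∷ ds)  = ≤-trans (≤-trans (n≤1+n _) (≤-reflexive (lemma (digitsValue ds))))
                                   (*-monoʳ-≤ 2 (<2^length ds))
    where lemma : ∀ v → 4 + 2 * v ≡ 2 * (2 + v)
          lemma = solve-∀
  <2^length (false ∷ ds) = ≤-trans (≤-reflexive (lemma (digitsValue ds)))
                                   (*-monoʳ-≤ 2 (<2^length ds))
    where lemma : ∀ v → 4 + 2 * v ≡ 2 * (2 + v)
          lemma = solve-∀

  2^digitCount≤ : ∀ n → 2 ^ digitCount n ≤ suc n
  2^digitCount≤ n = subst (λ m → 2 ^ digitCount n ≤ suc m) (value-digits n) (2^length≤ (digits n))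

  <2^digitCount : ∀ n → suc n < 2 ^ suc (digitCount n)
  <2^digitCount n = subst (λ m → suc m < 2 ^ suc (digitCount n)) (value-digits n) (<2^length (digits n))

  2^-cancel-< : ∀ m n → 2 ^ m < 2 ^ n → m < n
  2^-cancel-< m n p with m <? n
  ... | yes m<n = m<n
  ... | no m≮n  = contradiction (<-≤-trans p (^-monoʳ-≤ 2 (≮⇒≥ m≮n))) (<-irrefl refl)

digitCount-mono : ∀ {m n} → m ≤ n → digitCount m ≤ digitCount n
digitCount-mono {m} {n} m≤n = s≤s⁻¹ (2^-cancel-< _ _
  (≤-<-trans (2^digitCount≤ m) (≤-<-trans (s≤s m≤n) (<2^digitCount n))))

-- The count is a rounded logarithm of the successor, so it is the product of successors that makes
-- counts add up; the rounding costs one digit.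
digitCount-* : ∀ m a b → suc m ≤ suc a * suc b → digitCount m ≤ suc (digitCount a + digitCount b)
digitCount-* m a b p = s≤s⁻¹ (2^-cancel-< _ _ (begin-strict
  2 ^ digitCount m                                ≤⟨ 2^digitCount≤ m ⟩
  suc m                                           ≤⟨ p ⟩
  suc a * suc b                                   <⟨ *-mono-< (<2^digitCount a) (<2^digitCount b) ⟩
  2 ^ suc (digitCount a) * 2 ^ suc (digitCount b) ≡⟨ ^-distribˡ-+-* 2 (suc (digitCount a)) _ ⟨
  2 ^ (suc (digitCount a) + suc (digitCount b))   ≡⟨ cong (2 ^_) (+-suc (suc (digitCount a)) _) ⟩
  2 ^ suc (suc (digitCount a + digitCount b))     ∎))
  where open ≤-Reasoning

length≤size : ∀ bs → length bs ≤ ∣ list bool ∋ bs ∣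
length≤size []       = z≤n
length≤size (b ∷ bs) = s≤s (≤-trans (length≤size bs) (m≤n+m _ _))

size≤length : ∀ bs → ∣ list bool ∋ bs ∣ ≤ 4 * suc (length bs)
size≤length []       = s≤s z≤n
size≤length (b ∷ bs) = begin
  suc (∣ bool ∋ b ∣ + ∣ list bool ∋ bs ∣) ≤⟨ s≤s (+-mono-≤ (bool≤3 b) (size≤length bs)) ⟩
  4 + 4 * suc (length bs)                  ≡⟨ *-suc 4 (suc (length bs)) ⟨
  4 * suc (suc (length bs))                ∎
  where
  open ≤-Reasoning
  bool≤3 : ∀ b → ∣ bool ∋ b ∣ ≤ 3
  bool≤3 true  = ≤-refl
  bool≤3 false = s≤s z≤n

digitCount≤size : ∀ n → digitCount n ≤ ∣ bin ∋ n ∣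
digitCount≤size n = ≤-trans (length≤size (digits n)) (≤-reflexive (cong size (encode-digits n)))

size≤digitCount : ∀ n → ∣ bin ∋ n ∣ ≤ 4 * suc (digitCount n)
size≤digitCount n = ≤-trans (≤-reflexive (cong size (sym (encode-digits n)))) (size≤length (digits n))

nonzero : ℕ → Bool
nonzero zero    = false
nonzero (suc _) = true

truth-bin : ∀ n → truth (enc bin n) ≡ nonzero n
truth-bin n = trans (cong truth (sym (encode-digits n)))
                    (trans (lemma (digits n)) (cong nonzero (value-digits n)))
  where
  lemma : ∀ ds → truth (enc (list bool) ds) ≡ nonzero (digitsValue ds)
  lemma []           = refl
  lemma (true  ∷ ds) = refl
  lemma (false ∷ ds) = refl

truth-nat : ∀ n → truth (enc nat n) ≡ nonzero n
truth-nat zero    = refl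
truth-nat (suc n) = refl

truth-bool : ∀ b → truth (enc bool b) ≡ b
truth-bool true  = refl
truth-bool false = refl

-- Binary arithmetic

module _ {Γ : Ty} where

  digitsᵖ : ∀ {f} → PolyTime Γ bin f → PolyTime Γ (list bool) (digits ∘ f)
  digitsᵖ {f} F = recode F λ γ → sym (encode-digits (f γ))

  valueᵖ : ∀ {f} → PolyTime Γ (list bool) f → PolyTime Γ bin (digitsValue ∘ f)
  valueᵖ {f} F = recode F (encode-value ∘ f)

  oddᵖ : ∀ {f} → PolyTime Γ bin f → PolyTime Γ bin (λ γ → 1 + 2 * f γ)
  oddᵖ {f} F = ext (valueᵖ (constᵖ true ∷ᵖ digitsᵖ F))
                   (λ γ → cong (λ n → 1 + 2 * n) (value-digits (f γ)))

  evenᵖ : ∀ {f} → PolyTime Γ bin f → PolyTime Γ bin (λ γ → 2 + 2 * f γ)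
  evenᵖ {f} F = ext (valueᵖ (constᵖ false ∷ᵖ digitsᵖ F))
                    (λ γ → cong (λ n → 2 + 2 * n) (value-digits (f γ)))

  if-boolᵖ : ∀ {τ b f g} → PolyTime Γ bool b → PolyTime Γ τ f → PolyTime Γ τ g →
             PolyTime Γ τ (λ γ → if b γ then f γ else g γ)
  if-boolᵖ {b = b} B = ifᵖ B (truth-bool ∘ b)

  if-binᵖ : ∀ {τ n f g} → PolyTime Γ bin n → PolyTime Γ τ f → PolyTime Γ τ g →
            PolyTime Γ τ (λ γ → if nonzero (n γ) then f γ else g γ)
  if-binᵖ {n = n} N = ifᵖ N (truth-bin ∘ n)

  if-natᵖ : ∀ {τ n f g} → PolyTime Γ nat n → PolyTime Γ τ f → PolyTime Γ τ g →
            PolyTime Γ τ (λ γ → if nonzero (n γ) then f γ else g γ)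
  if-natᵖ {n = n} N = ifᵖ N (truth-nat ∘ n)

private
  size≤max : ∀ x y → 1 + (4 * suc x + 4 * suc y) ≤ 9 * suc (x ⊔ y)
  size≤max x y = begin
    1 + (4 * suc x + 4 * suc y)   ≤⟨ s≤s (+-mono-≤ (*-monoʳ-≤ 4 (s≤s (m≤m⊔n x y)))
                                                   (*-monoʳ-≤ 4 (s≤s (m≤n⊔m x y)))) ⟩
    1 + (4 * m + 4 * m)           ≤⟨ +-monoˡ-≤ (4 * m + 4 * m) (s≤s z≤n) ⟩
    m + (4 * m + 4 * m)           ≡⟨ lemma m ⟩
    9 * m                         ∎
    where
    open ≤-Reasoning
    m = suc (x ⊔ y)
    lemma : ∀ m → m + (4 * m + 4 * m) ≡ 9 * m
    lemma = solve-∀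

  maxCount : ℕ × ℕ → ℕ
  maxCount (m , n) = digitCount m ⊔ digitCount n

  maxCount≤size : ∀ mn → maxCount mn ≤ ∣ bin ⊗ bin ∋ mn ∣
  maxCount≤size (m , n) = ≤-trans (m⊔n≤m+n (digitCount m) (digitCount n))
    (≤-trans (+-mono-≤ (digitCount≤size m) (digitCount≤size n)) (n≤1+n _))

  size≤maxCount : ∀ mn → ∣ bin ⊗ bin ∋ mn ∣ ≤ 9 * suc (maxCount mn)
  size≤maxCount (m , n) = ≤-trans
    (s≤s (+-mono-≤ (size≤digitCount m) (size≤digitCount n))) (size≤max _ _)

-- The successor of 2 + 2 n is 1 + 2 (n + 1), so the successor of the higher digits is carried along
-- instead of a carry bit.
sucStep : Bool × ℕ × ℕ → ℕ × ℕ
sucStep (d , n , n+1) = if d then (1 + 2 * n , 2 + 2 * n) else (2 + 2 * n , 1 + 2 * n+1)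

sucStep-correct : ∀ ds → foldr (λ d s → sucStep (d , s)) (0 , 1) ds ≡ (digitsValue ds , suc (digitsValue ds))
sucStep-correct []           = refl
sucStep-correct (true ∷ ds)  rewrite sucStep-correct ds = refl
sucStep-correct (false ∷ ds) rewrite sucStep-correct ds =
  cong (λ n → 2 + 2 * digitsValue ds , suc n) (*-suc 2 (digitsValue ds))

-- There is no digit 0 to put in front. Instead 2 (1 + 2 n) = 2 + 2 (2 n) uses the double of the
-- rest, and 2 (2 + 2 n) = 2 + 2 (1 + 2 n) uses the rest itself.
doubleStep : Bool × ℕ × ℕ → ℕ × ℕ
doubleStep (d , n , 2n) = if d then (1 + 2 * n , 2 + 2 * 2n) else (2 + 2 * n , 2 + 2 * (1 + 2 * n))

doubleStep-correct : ∀ ds → foldr (λ d s → doubleStep (d , s)) (0 , 0) ds ≡ (digitsValue ds , 2 * digitsValue ds)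
doubleStep-correct []           = refl
doubleStep-correct (true ∷ ds)  rewrite doubleStep-correct ds = cong (1 + 2 * digitsValue ds ,_) (lemma (digitsValue ds))
  where lemma : ∀ v → 2 + 2 * (2 * v) ≡ 2 * (1 + 2 * v)
        lemma = solve-∀
doubleStep-correct (false ∷ ds) rewrite doubleStep-correct ds = cong (2 + 2 * digitsValue ds ,_) (lemma (digitsValue ds))
  where lemma : ∀ v → 2 + 2 * (1 + 2 * v) ≡ 2 * (2 + 2 * v)
        lemma = solve-∀

-- The standard binary digits, least significant first, of n and 1 + n.
bitsStep : Bool × List Bool × List Bool → List Bool × List Bool
bitsStep (d , bs , bs⁺) = if d then (true ∷ bs , false ∷ bs⁺) else (false ∷ bs⁺ , true ∷ bs⁺)

bits : ℕ → List Bool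
bits n = proj₁ (foldr (λ d s → bitsStep (d , s)) ([] , true ∷ []) (digits n))

bit : Bool → ℕ
bit b = if b then 1 else 0

bitValue : List Bool → ℕ
bitValue []       = 0
bitValue (b ∷ bs) = bit b + 2 * bitValue bs

bitValue-bits : ∀ n → bitValue (bits n) ≡ n
bitValue-bits n = trans (proj₁ (lemma (digits n))) (value-digits n)
  where
  lemma : ∀ ds → let (bs , bs⁺) = foldr (λ d s → bitsStep (d , s)) ([] , true ∷ []) ds in
          bitValue bs ≡ digitsValue ds × bitValue bs⁺ ≡ suc (digitsValue ds)
  lemma []           = refl , refl
  lemma (true ∷ ds)  = let p , q = lemma ds in
    cong (λ v → 1 + 2 * v) p , trans (cong (2 *_) q) (*-suc 2 (digitsValue ds))
  lemma (false ∷ ds) = let p , q = lemma ds in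
    trans (cong (2 *_) q) (*-suc 2 (digitsValue ds)) ,
    trans (cong (λ v → 1 + 2 * v) q) (cong suc (*-suc 2 (digitsValue ds)))

module _ {Γ : Ty} where

  sucᵖ : ∀ {f} → PolyTime Γ bin f → PolyTime Γ bin (suc ∘ f)
  sucᵖ {f} F = ext (sndᵖ (foldr-additiveᵖ (digitsᵖ F) (constᵖ (0 , 1))
      (if-boolᵖ eltᵖ (pairᵖ (oddᵖ (fstᵖ accᵖ)) (evenᵖ (fstᵖ accᵖ)))
                     (pairᵖ (evenᵖ (fstᵖ accᵖ)) (oddᵖ (sndᵖ accᵖ))))
      maxCount 9 (λ _ → 1) maxCount≤size size≤maxCount (bounded-const 1)
      λ { _ true  (m , n) → ⊔-lub
            (≤-trans (≤-reflexive (digitCount-odd m)) (s≤s (m≤m⊔n _ _)))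
            (≤-trans (≤-reflexive (digitCount-even m)) (s≤s (m≤m⊔n _ _)))
        ; _ false (m , n) → ⊔-lub
            (≤-trans (≤-reflexive (digitCount-even m)) (s≤s (m≤m⊔n _ _)))
            (≤-trans (≤-reflexive (digitCount-odd n)) (s≤s (m≤n⊔m (digitCount m) _))) }))
    λ γ → trans (cong proj₂ (sucStep-correct (digits (f γ)))) (cong suc (value-digits (f γ)))

  doubleᵖ : ∀ {f} → PolyTime Γ bin f → PolyTime Γ bin (λ γ → 2 * f γ)
  doubleᵖ {f} F = ext (sndᵖ (foldr-additiveᵖ (digitsᵖ F) (constᵖ (0 , 0))
      (if-boolᵖ eltᵖ (pairᵖ (oddᵖ (fstᵖ accᵖ)) (evenᵖ (sndᵖ accᵖ)))
                     (pairᵖ (evenᵖ (fstᵖ accᵖ)) (evenᵖ (oddᵖ (fstᵖ accᵖ)))))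
      maxCount 9 (λ _ → 2) maxCount≤size size≤maxCount (bounded-const 2)
      λ { _ true  (m , n) → ⊔-lub
            (≤-trans (≤-reflexive (digitCount-odd m)) (≤-trans (s≤s (m≤m⊔n _ _)) (n≤1+n _)))
            (≤-trans (≤-reflexive (digitCount-even n)) (≤-trans (s≤s (m≤n⊔m (digitCount m) _)) (n≤1+n _)))
        ; _ false (m , n) → ⊔-lub
            (≤-trans (≤-reflexive (digitCount-even m)) (≤-trans (s≤s (m≤m⊔n _ _)) (n≤1+n _)))
            (≤-trans (≤-reflexive (trans (digitCount-even (1 + 2 * m)) (cong suc (digitCount-odd m))))
                     (s≤s (s≤s (m≤m⊔n _ _)))) }))
    λ γ → trans (cong proj₂ (doubleStep-correct (digits (f γ)))) (cong (2 *_) (value-digits (f γ)))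

  predᵖ : ∀ {f} → PolyTime Γ bin f → PolyTime Γ bin (pred ∘ f)
  predᵖ {f} F = ext
    -- The number 0 has no digits and its head defaults to `false`, so a second test separates it
    -- from the positive even numbers.
    (if-boolᵖ (headOrᵖ refl (digitsᵖ F)) (doubleᵖ (valueᵖ (tailᵖ (digitsᵖ F))))
      (if-binᵖ F (oddᵖ (valueᵖ (tailᵖ (digitsᵖ F)))) (constᵖ 0)))
    λ γ → subst (λ n → pred′ (digits (f γ)) n ≡ pred n) (value-digits (f γ)) (lemma (digits (f γ)))
    where
    pred′ : List Bool → ℕ → ℕ
    pred′ ds n = if headOr false ds then 2 * digitsValue (tail ds)
                 else if nonzero n then 1 + 2 * digitsValue (tail ds) else 0
    lemma : ∀ ds → pred′ ds (digitsValue ds) ≡ pred (digitsValue ds)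
    lemma []           = refl
    lemma (true ∷ ds)  = refl
    lemma (false ∷ ds) = refl

  bitsᵖ : ∀ {f} → PolyTime Γ bin f → PolyTime Γ (list bool) (bits ∘ f)
  bitsᵖ F = fstᵖ (foldr-additiveᵖ (digitsᵖ F) (constᵖ ([] , true ∷ []))
    (if-boolᵖ eltᵖ (pairᵖ (constᵖ true ∷ᵖ fstᵖ accᵖ) (constᵖ false ∷ᵖ sndᵖ accᵖ))
                   (pairᵖ (constᵖ false ∷ᵖ sndᵖ accᵖ) (constᵖ true ∷ᵖ sndᵖ accᵖ)))
    (λ (bs , cs) → length bs ⊔ length cs) 9 (λ _ → 1)
    (λ (bs , cs) → ≤-trans (m⊔n≤m+n (length bs) (length cs))
      (≤-trans (+-mono-≤ (length≤size bs) (length≤size cs)) (n≤1+n _)))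
    (λ (bs , cs) → ≤-trans (s≤s (+-mono-≤ (size≤length bs) (size≤length cs))) (size≤max _ _))
    (bounded-const 1)
    λ { _ true  (bs , cs) → ≤-refl
      ; _ false (bs , cs) → ⊔-lub (s≤s (m≤n⊔m (length bs) _)) (s≤s (m≤n⊔m (length bs) _)) })

-- The pairs of bits of two numbers, most significant first; padded with zeros.

BitPairs : Set
BitPairs = List (Bool × Bool)

alignStep : (List Bool × List Bool) × BitPairs → (List Bool × List Bool) × BitPairs
alignStep ((bs , cs) , ps) = (tail bs , tail cs) , (headOr false bs , headOr false cs) ∷ ps

-- The list `bs ++ cs` is only a clock that runs long enough for both lists; surplus rounds produce
-- leading pairs of zeros.
align : List Bool → List Bool → BitPairs
align bs cs = proj₂ (foldl (λ s (_ : Bool) → alignStep s) ((bs , cs) , []) (bs ++ cs))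

-- Horner's rule for two numbers at once: a function of both can be computed online if its value
-- survives appending one bit to each. Leading zero pairs leave `F 0 0` unchanged.
horner : ∀ {B : Set} (h : B → Bool × Bool → B) (F : ℕ → ℕ → B) →
  (∀ m n b c → h (F m n) (b , c) ≡ F (bit b + 2 * m) (bit c + 2 * n)) →
  ∀ bs cs → foldl h (F 0 0) (align bs cs) ≡ F (bitValue bs) (bitValue cs)
horner h F h-F bs cs = go (bs ++ cs) bs cs []
  (≤-trans (m≤m+n _ _) (≤-reflexive (sym (length-++ bs))))
  (≤-trans (m≤n+m _ _) (≤-reflexive (sym (length-++ bs))))
  where
  length-tail : ∀ {n} (bs : List Bool) → length bs ≤ suc n → length (tail bs) ≤ n
  length-tail []       _       = z≤n
  length-tail (_ ∷ bs) (s≤s p) = p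
  uncons : ∀ bs → bitValue bs ≡ bit (headOr false bs) + 2 * bitValue (tail bs)
  uncons []       = refl
  uncons (_ ∷ _)  = refl
  go : ∀ (clock : List Bool) bs cs ps → length bs ≤ length clock → length cs ≤ length clock →
       foldl h (F 0 0) (proj₂ (foldl (λ s _ → alignStep s) ((bs , cs) , ps) clock))
       ≡ foldl h (F (bitValue bs) (bitValue cs)) ps
  go []          []       []       ps _ _ = refl
  go (_ ∷ clock) bs       cs       ps p q = trans
    (go clock (tail bs) (tail cs) _ (length-tail bs p) (length-tail cs q))
    (cong (λ s → foldl h s ps) (trans
      (h-F (bitValue (tail bs)) (bitValue (tail cs)) (headOr false bs) (headOr false cs))
      (sym (cong₂ F (uncons bs) (uncons cs)))))

alignᵖ : ∀ {Γ f g} → PolyTime Γ (list bool) f → PolyTime Γ (list bool) g →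
         PolyTime Γ (list (bool ⊗ bool)) (λ γ → align (f γ) (g γ))
alignᵖ F G = sndᵖ (foldl-additiveᵖ (F ++ᵖ G) (pairᵖ (pairᵖ F G) (constᵖ []))
  (pairᵖ (pairᵖ (tailᵖ (fstᵖ (fstᵖ accᵖ))) (tailᵖ (sndᵖ (fstᵖ accᵖ))))
         (pairᵖ (headOrᵖ refl (fstᵖ (fstᵖ accᵖ))) (headOrᵖ refl (sndᵖ (fstᵖ accᵖ))) ∷ᵖ sndᵖ accᵖ))
  ∣ (list bool ⊗ list bool) ⊗ list (bool ⊗ bool) ∋_∣ 1 (λ _ → 8) (λ _ → ≤-refl)
  (λ b → ≤-trans (n≤1+n _) (≤-reflexive (sym (*-identityˡ _)))) (bounded-const 8)
  λ { γ x ((bs , cs) , ps) → begin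
    _ ≤⟨ s≤s (+-mono-≤ (s≤s (+-mono-≤ (tail≤ bs) (tail≤ cs)))
           (+-monoˡ-≤ (∣ list (bool ⊗ bool) ∋ ps ∣) (s≤s (s≤s (+-mono-≤ (head≤ bs) (head≤ cs)))))) ⟩
    _ ≡⟨ lemma ∣ list bool ∋ bs ∣ ∣ list bool ∋ cs ∣ ∣ list (bool ⊗ bool) ∋ ps ∣ ⟩
    _ ∎ })
  where
  open ≤-Reasoning
  lemma : ∀ x y z → 1 + ((1 + (x + y)) + (8 + z)) ≡ 8 + (1 + (1 + x + y) + z)
  lemma = solve-∀
  tail≤ : ∀ bs → ∣ list bool ∋ tail bs ∣ ≤ ∣ list bool ∋ bs ∣
  tail≤ []       = ≤-refl
  tail≤ (b ∷ bs) = m≤n+m _ (1 + ∣ bool ∋ b ∣)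
  head≤ : ∀ bs → ∣ bool ∋ headOr false bs ∣ ≤ 3
  head≤ []           = s≤s z≤n
  head≤ (true ∷ bs)  = ≤-refl
  head≤ (false ∷ bs) = s≤s z≤n

-- Most significant bits come first and the accumulator is a number, so carries are absorbed by the
-- successor function.
addStep : (Bool × Bool) × ℕ → ℕ
addStep ((b , c) , s) = if b then suc (if c then suc (2 * s) else 2 * s)
                        else (if c then suc (2 * s) else 2 * s)

digitCount-≤even : ∀ {m n} → m ≤ 2 + 2 * n → digitCount m ≤ suc (digitCount n)
digitCount-≤even {n = n} p = ≤-trans (digitCount-mono p) (≤-reflexive (digitCount-even n))

addStep-correct : ∀ m n b c → addStep ((b , c) , m + n) ≡ bit b + 2 * m + (bit c + 2 * n)
addStep-correct m n true true   = lemma m n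
  where lemma : ∀ m n → 2 + 2 * (m + n) ≡ 1 + 2 * m + (1 + 2 * n)
        lemma = solve-∀
addStep-correct m n true false  = cong suc (*-distribˡ-+ 2 m n)
addStep-correct m n false true  = lemma m n
  where lemma : ∀ m n → 1 + 2 * (m + n) ≡ 2 * m + (1 + 2 * n)
        lemma = solve-∀
addStep-correct m n false false = *-distribˡ-+ 2 m n

infixl 6 _+ᵖ_ _∸ᵖ_
infixl 7 _*ᵖ_

_+ᵖ_ : ∀ {Γ f g} → PolyTime Γ bin f → PolyTime Γ bin g → PolyTime Γ bin (λ γ → f γ + g γ)
_+ᵖ_ {Γ} {f} {g} F G = ext
  (foldl-additiveᵖ (alignᵖ (bitsᵖ F) (bitsᵖ G)) (constᵖ 0)
    (if-boolᵖ (fstᵖ eltᵖ) (sucᵖ low) low)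
    digitCount 4 (λ _ → 1) digitCount≤size size≤digitCount (bounded-const 1)
    (λ { _ (b , c) s → digitCount-≤even {n = s} (step≤ b c s) }))
  (λ γ → trans (horner (λ s bc → addStep (bc , s)) _+_ addStep-correct (bits (f γ)) (bits (g γ)))
               (cong₂ _+_ (bitValue-bits (f γ)) (bitValue-bits (g γ))))
  where
  low = if-boolᵖ (sndᵖ eltᵖ) (sucᵖ (doubleᵖ accᵖ)) (doubleᵖ accᵖ)
  step≤ : ∀ b c s → addStep ((b , c) , s) ≤ 2 + 2 * s
  step≤ true  true  s = ≤-refl
  step≤ true  false s = n≤1+n _
  step≤ false true  s = n≤1+n _
  step≤ false false s = m≤n+m _ 2

subtractBit : Bool → ℕ → ℕ
subtractBit b n = if b then pred n else n

addBit : Bool → ℕ → ℕ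
addBit b n = if b then suc n else n

-- Keeps the differences m ∸ n and n ∸ m of the numbers read so far, one of
-- which is zero.
monusStep : (Bool × Bool) × ℕ × ℕ → ℕ × ℕ
monusStep ((b , c) , d , e) =
  (if nonzero e then 0 else subtractBit c (addBit b (2 * d))) ,
  (if nonzero d then 0 else subtractBit b (addBit c (2 * e)))

private
  bitOps : ∀ b c n → subtractBit c (addBit b n) ≡ bit b + n ∸ bit c
  bitOps true  true  n = refl
  bitOps true  false n = refl
  bitOps false true  zero    = refl
  bitOps false true  (suc n) = refl
  bitOps false false n = refl

  bit≤1 : ∀ b → bit b ≤ 1
  bit≤1 true  = ≤-refl
  bit≤1 false = z≤n

  -- If n ≤ m the difference is exact and can be doubled and corrected by the bits. Otherwise 2 m +
  -- 1 < 2 n, so no choice of bits makes the new difference positive.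
  monus-half : ∀ m n b c →
    (if nonzero (n ∸ m) then 0 else subtractBit c (addBit b (2 * (m ∸ n))))
    ≡ bit b + 2 * m ∸ (bit c + 2 * n)
  monus-half m n b c with n ≤? m
  ... | yes n≤m rewrite m≤n⇒m∸n≡0 n≤m = begin
    subtractBit c (addBit b (2 * (m ∸ n)))  ≡⟨ bitOps b c (2 * (m ∸ n)) ⟩
    bit b + 2 * (m ∸ n) ∸ bit c             ≡⟨ cong (λ d → bit b + d ∸ bit c) (*-distribˡ-∸ 2 m n) ⟩
    bit b + (2 * m ∸ 2 * n) ∸ bit c         ≡⟨ cong (_∸ bit c) (+-∸-assoc (bit b) (*-monoʳ-≤ 2 n≤m)) ⟨
    bit b + 2 * m ∸ 2 * n ∸ bit c           ≡⟨ ∸-+-assoc (bit b + 2 * m) (2 * n) (bit c) ⟩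
    bit b + 2 * m ∸ (2 * n + bit c)         ≡⟨ cong (bit b + 2 * m ∸_) (+-comm (2 * n) (bit c)) ⟩
    bit b + 2 * m ∸ (bit c + 2 * n)         ∎
    where open ≡-Reasoning
  ... | no n≰m with n ∸ m in eq
  ...   | zero  = contradiction (m∸n≡0⇒m≤n eq) n≰m
  ...   | suc _ = sym (m≤n⇒m∸n≡0 (begin
    bit b + 2 * m   ≤⟨ +-monoˡ-≤ (2 * m) (≤-trans (bit≤1 b) (n≤1+n 1)) ⟩
    2 + 2 * m       ≡⟨ *-suc 2 m ⟨
    2 * suc m       ≤⟨ *-monoʳ-≤ 2 (≰⇒> n≰m) ⟩
    2 * n           ≤⟨ m≤n+m _ (bit c) ⟩
    bit c + 2 * n   ∎))
    where open ≤-Reasoning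

monusStep-correct : ∀ m n b c → monusStep ((b , c) , m ∸ n , n ∸ m) ≡
  (bit b + 2 * m ∸ (bit c + 2 * n) , bit c + 2 * n ∸ (bit b + 2 * m))
monusStep-correct m n b c = cong₂ _,_ (monus-half m n b c) (monus-half n m c b)

_∸ᵖ_ : ∀ {Γ f g} → PolyTime Γ bin f → PolyTime Γ bin g → PolyTime Γ bin (λ γ → f γ ∸ g γ)
_∸ᵖ_ {Γ} {f} {g} F G = ext
  (fstᵖ (foldl-additiveᵖ (alignᵖ (bitsᵖ F) (bitsᵖ G)) (constᵖ (0 , 0))
    (pairᵖ (if-binᵖ (sndᵖ accᵖ) (constᵖ 0)
              (subtractBitᵖ (sndᵖ eltᵖ) (addBitᵖ (fstᵖ eltᵖ) (doubleᵖ (fstᵖ accᵖ)))))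
           (if-binᵖ (fstᵖ accᵖ) (constᵖ 0)
              (subtractBitᵖ (fstᵖ eltᵖ) (addBitᵖ (sndᵖ eltᵖ) (doubleᵖ (sndᵖ accᵖ))))))
    maxCount 9 (λ _ → 1) maxCount≤size size≤maxCount (bounded-const 1)
    (λ { _ (b , c) (d , e) → ⊔-lub
      (≤-trans (half≤ (nonzero e) b c d) (s≤s (m≤m⊔n _ _)))
      (≤-trans (half≤ (nonzero d) c b e) (s≤s (m≤n⊔m (digitCount d) _))) })))
  (λ γ → trans (cong proj₁ (horner (λ s bc → monusStep (bc , s)) (λ m n → m ∸ n , n ∸ m)
                              monusStep-correct (bits (f γ)) (bits (g γ))))
               (cong₂ _∸_ (bitValue-bits (f γ)) (bitValue-bits (g γ))))
  where
  subtractBitᵖ : ∀ {Δ b n} → PolyTime Δ bool b → PolyTime Δ bin n →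
                 PolyTime Δ bin (λ δ → subtractBit (b δ) (n δ))
  subtractBitᵖ B N = if-boolᵖ B (predᵖ N) N
  addBitᵖ : ∀ {Δ b n} → PolyTime Δ bool b → PolyTime Δ bin n →
            PolyTime Δ bin (λ δ → addBit (b δ) (n δ))
  addBitᵖ B N = if-boolᵖ B (sucᵖ N) N
  half≤ : ∀ t b c n → digitCount (if t then 0 else subtractBit c (addBit b (2 * n)))
          ≤ suc (digitCount n)
  half≤ true  b c n = z≤n
  half≤ false b c n = digitCount-≤even {n = n} (begin
    subtractBit c (addBit b (2 * n)) ≡⟨ bitOps b c (2 * n) ⟩
    bit b + 2 * n ∸ bit c            ≤⟨ m∸n≤m (bit b + 2 * n) (bit c) ⟩
    bit b + 2 * n                    ≤⟨ +-monoˡ-≤ (2 * n) (≤-trans (bit≤1 b) (n≤1+n 1)) ⟩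
    2 + 2 * n                        ∎)
    where open ≤-Reasoning

-- By (1 + 2 v) n = n + 2 (v n) and (2 + 2 v) n = 2 (n + v n), one pass over the digits of the first
-- factor suffices. A round adds about as many digits as the second factor has, which lies in the
-- environment, so growth is additive.
_*ᵖ_ : ∀ {Γ f g} → PolyTime Γ bin f → PolyTime Γ bin g → PolyTime Γ bin (λ γ → f γ * g γ)
_*ᵖ_ {Γ} {f} {g} F G = ext
  (foldr-additiveᵖ (digitsᵖ F) (constᵖ 0)
    (if-boolᵖ eltᵖ (applyᵖ G envᵖ +ᵖ doubleᵖ accᵖ) (doubleᵖ (applyᵖ G envᵖ +ᵖ accᵖ)))
    digitCount 4 (λ (γ , _) → 2 + digitCount (g γ)) digitCount≤size size≤digitCount
    (bounded-+ (bounded-const 2) (bounded-≤ (λ (γ , _) → digitCount≤size (g γ))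
                                            (size-bounded (applyᵖ G (fstᵖ idᵖ)))))
    λ { γ d s → step≤ d (g γ) s })
  (λ γ → trans (lemma (digits (f γ)) (g γ)) (cong (_* g γ) (value-digits (f γ))))
  where
  mulStep : Bool → ℕ → ℕ → ℕ
  mulStep d n s = if d then n + 2 * s else 2 * (n + s)
  lemma : ∀ ds n → foldr (λ d s → mulStep d n s) 0 ds ≡ digitsValue ds * n
  lemma []           n = refl
  lemma (true ∷ ds)  n = trans (cong (λ s → n + 2 * s) (lemma ds n))
                               (cong (n +_) (sym (*-assoc 2 (digitsValue ds) n)))
  lemma (false ∷ ds) n = trans (cong (λ s → 2 * (n + s)) (lemma ds n)) (ring (digitsValue ds) n)
    where ring : ∀ v n → 2 * (n + v * n) ≡ (2 + 2 * v) * n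
          ring = solve-∀
  step≤ : ∀ d n s → digitCount (mulStep d n s) ≤ 2 + digitCount n + digitCount s
  step≤ d n s = begin
    digitCount (mulStep d n s)                    ≤⟨ digitCount-* (mulStep d n s) n (1 + 2 * s) (bound d) ⟩
    suc (digitCount n + digitCount (1 + 2 * s))   ≡⟨ cong (λ k → suc (digitCount n + k)) (digitCount-odd s) ⟩
    suc (digitCount n + suc (digitCount s))       ≡⟨ cong suc (+-suc (digitCount n) _) ⟩
    2 + digitCount n + digitCount s               ∎
    where
    open ≤-Reasoning
    bound : ∀ d → suc (mulStep d n s) ≤ suc n * (2 + 2 * s)
    bound true  = subst (suc (n + 2 * s) ≤_) (ring n s) (m≤m+n _ _)
      where ring : ∀ n s → suc (n + 2 * s) + (1 + n + 2 * (n * s)) ≡ suc n * (2 + 2 * s)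
            ring = solve-∀
    bound false = subst (suc (2 * (n + s)) ≤_) (ring n s) (m≤m+n _ _)
      where ring : ∀ n s → suc (2 * (n + s)) + (1 + 2 * (n * s)) ≡ suc n * (2 + 2 * s)
            ring = solve-∀

-- The reduction on encodings

module _ {Γ : Ty} where

  suc-natᵖ : ∀ {f} → PolyTime Γ nat f → PolyTime Γ nat (suc ∘ f)
  suc-natᵖ F = recode (pairᵖ (constᵖ {τ = nat} 0) F) λ _ → refl

  -- A unary numeral has the code of a list of zeros, so its predecessor is a tail.
  pred-natᵖ : ∀ {f} → PolyTime Γ nat f → PolyTime Γ nat (pred ∘ f)
  pred-natᵖ {f} F = recode (tailᵖ (recode {τ = list nat} F (unary ∘ f))) (unary-pred ∘ f)
    where
    unary : ∀ n → enc nat n ≡ enc (list nat) (replicate n 0)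
    unary zero    = refl
    unary (suc n) = cong (leaf ∙_) (unary n)
    unary-pred : ∀ n → enc (list nat) (tail (replicate n 0)) ≡ enc nat (pred n)
    unary-pred zero    = refl
    unary-pred (suc n) = sym (unary n)

lengthᵖ : ∀ {Γ A l} → PolyTime Γ (list A) l → PolyTime Γ nat (length ∘ l)
lengthᵖ {A = A} {l} L = ext
  (foldr-additiveᵖ L (constᵖ 0) (suc-natᵖ accᵖ) ∣ nat ∋_∣ 1 (λ _ → 2) (λ _ → ≤-refl)
    (λ n → ≤-trans (n≤1+n _) (≤-reflexive (sym (*-identityˡ _))))
    (bounded-const 2) (λ _ _ _ → ≤-refl))
  (lemma ∘ l)
  where
  lemma : ∀ xs → foldr (λ _ → suc) 0 xs ≡ length xs
  lemma []       = refl
  lemma (_ ∷ xs) = cong suc (lemma xs)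

-- scale (1 + j) qs is the product of the numerator of the fraction number j with
-- the denominators of the other fractions; scale 0 qs is the product of all
-- denominators.

factor : ℕ → ℕ × ℕ → ℕ
factor i (a , b) = if nonzero i then (if nonzero (pred i) then b else a) else b

scale : ℕ → List (ℕ × ℕ) → ℕ
scale i []       = 1
scale i (q ∷ qs) = factor i q * scale (pred i) qs

private
  scaleStep : (ℕ × ℕ) × ℕ × ℕ → ℕ × ℕ
  scaleStep (q , i , x) = pred i , x * factor i q

  scaleStep-correct : ∀ qs i x → proj₂ (foldl (λ s q → scaleStep (q , s)) (i , x) qs) ≡ x * scale i qs
  scaleStep-correct []       i x = sym (*-identityʳ x)
  scaleStep-correct (q ∷ qs) i x = trans (scaleStep-correct qs (pred i) (x * factor i q))
                                         (*-assoc x (factor i q) (scale (pred i) qs))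

  size-nat : ∀ n → ∣ nat ∋ n ∣ ≡ 1 + 2 * n
  size-nat zero    = refl
  size-nat (suc n) = trans (cong (2 +_) (size-nat n)) (cong suc (sym (*-suc 2 n)))

  scaleMeasure : ℕ × ℕ → ℕ
  scaleMeasure (i , x) = i + digitCount x

  scaleMeasure≤size : ∀ s → scaleMeasure s ≤ ∣ nat ⊗ bin ∋ s ∣
  scaleMeasure≤size (i , x) = ≤-trans (+-mono-≤
    (≤-trans (m≤m+n i (i + 0)) (≤-trans (n≤1+n _) (≤-reflexive (sym (size-nat i)))))
    (digitCount≤size x)) (n≤1+n _)

  size≤scaleMeasure : ∀ s → ∣ nat ⊗ bin ∋ s ∣ ≤ 6 * suc (scaleMeasure s)
  size≤scaleMeasure (i , x) = begin
    1 + ∣ nat ∋ i ∣ + ∣ bin ∋ x ∣   ≤⟨ s≤s (+-mono-≤ (≤-reflexive (size-nat i)) (size≤digitCount x)) ⟩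
    1 + (1 + 2 * i) + 4 * suc d     ≤⟨ m≤m+n _ (4 * i + 2 * d) ⟩
    1 + (1 + 2 * i) + 4 * suc d + (4 * i + 2 * d) ≡⟨ lemma i d ⟩
    6 * suc (i + d)                 ∎
    where
    open ≤-Reasoning
    d = digitCount x
    lemma : ∀ i d → 1 + (1 + 2 * i) + 4 * suc d + (4 * i + 2 * d) ≡ 6 * suc (i + d)
    lemma = solve-∀

scaleᵖ : ∀ {Γ f g} → PolyTime Γ nat f → PolyTime Γ (list (bin ⊗ bin)) g →
         PolyTime Γ bin (λ γ → scale (f γ) (g γ))
scaleᵖ {Γ} {f} {g} F G = ext
  (sndᵖ (foldl-additiveᵖ G (pairᵖ F (constᵖ 1))
    (pairᵖ (pred-natᵖ (fstᵖ accᵖ)) (sndᵖ accᵖ *ᵖ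
      if-natᵖ (fstᵖ accᵖ) (if-natᵖ (pred-natᵖ (fstᵖ accᵖ)) (sndᵖ eltᵖ) (fstᵖ eltᵖ)) (sndᵖ eltᵖ)))
    scaleMeasure 6 (λ (_ , a , b) → 1 + (digitCount a + digitCount b))
    scaleMeasure≤size size≤scaleMeasure
    (bounded-+ (bounded-const 1) (bounded-+
      (bounded-≤ (λ (_ , a , _) → digitCount≤size a) (size-bounded (fstᵖ {τ = bin} (sndᵖ idᵖ))))
      (bounded-≤ (λ (_ , _ , b) → digitCount≤size b) (size-bounded (sndᵖ {σ = bin} (sndᵖ idᵖ))))))
    λ { _ (a , b) (i , x) → step≤ a b i x }))
  (λ γ → trans (scaleStep-correct (g γ) (f γ) 1) (*-identityˡ _))
  where
  factor≤ : ∀ a b i → digitCount (factor i (a , b)) ≤ digitCount a + digitCount b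
  factor≤ a b zero          = m≤n+m _ _
  factor≤ a b (suc zero)    = m≤m+n _ _
  factor≤ a b (suc (suc i)) = m≤n+m _ _
  step≤ : ∀ a b i x → pred i + digitCount (x * factor i (a , b))
                      ≤ 1 + (digitCount a + digitCount b) + (i + digitCount x)
  step≤ a b i x = begin
    pred i + digitCount (x * y)               ≤⟨ +-mono-≤ (pred[n]≤n {i})
      (digitCount-* (x * y) x y (s≤s (≤-trans (*-monoʳ-≤ x (n≤1+n y)) (m≤n+m _ y)))) ⟩
    i + suc (digitCount x + digitCount y)     ≡⟨ lemma i (digitCount x) (digitCount y) ⟩
    1 + digitCount y + (i + digitCount x)     ≤⟨ +-monoˡ-≤ (i + digitCount x) (s≤s (factor≤ a b i)) ⟩
    1 + (digitCount a + digitCount b) + (i + digitCount x) ∎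
    where
    open ≤-Reasoning
    y = factor i (a , b)
    lemma : ∀ i x y → i + suc (x + y) ≡ 1 + y + (i + x)
    lemma = solve-∀

-- Variable 0 is a dummy used for padding, and variable 1 + j stands for job j.

weightOf : List (ℕ × ℕ) → ℕ → ℕ
weightOf qs i = if nonzero i then scale i qs else 0

memberStep : Bool × ℕ × List ℕ → ℕ × List ℕ
memberStep (b , i , is) = pred i , (if b then i ∷ is else is)

-- The right fold meets the last job first, so a counter going down from n supplies the variable
-- numbers.
members : ℕ → List Bool → List ℕ
members n bs = proj₂ (foldr (λ b s → memberStep (b , s)) (n , []) bs)

-- The inserted number comes from the accumulator, so the additive fold does not apply. The
-- potential reserves room for one copy of the current counter per remaining bit; the counter only
-- decreases.
membersᵖ : ∀ {Γ f g} → PolyTime Γ nat f → PolyTime Γ (list bool) g →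
           PolyTime Γ (list nat) (λ γ → members (f γ) (g γ))
membersᵖ {Γ} {f} {g} F G = sndᵖ (ext
  (foldlᵖ (reverseᵖ G) (pairᵖ F (constᵖ []))
    (pairᵖ (pred-natᵖ (fstᵖ accᵖ)) (if-boolᵖ eltᵖ (fstᵖ accᵖ ∷ᵖ sndᵖ accᵖ) (sndᵖ accᵖ)))
    (λ _ → Φ)
    (λ _ bs (i , is) → m≤m+n _ _)
    (λ { _ b bs (i , is) → step≤ b bs i is })
    (bounded-+ (bounded-+ (bounded-+ (bounded-const 1) (size-bounded F)) (bounded-const 1))
      (bounded-* (bounded-≤ (λ γ → length≤size (reverse (g γ))) (size-bounded (reverseᵖ G)))
                 (bounded-+ (bounded-const 1) (size-bounded F)))))
  (λ γ → reverse-foldl (λ s b → memberStep (b , s)) (f γ , []) (g γ)))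
  where
  Φ : List Bool → ℕ × List ℕ → ℕ
  Φ bs (i , is) = 1 + ∣ nat ∋ i ∣ + ∣ list nat ∋ is ∣ + length bs * (1 + ∣ nat ∋ i ∣)
  pred≤ : ∀ i → ∣ nat ∋ pred i ∣ ≤ ∣ nat ∋ i ∣
  pred≤ zero    = ≤-refl
  pred≤ (suc i) = m≤n+m _ 2
  insert≤ : ∀ b i is → ∣ list nat ∋ (if b then i ∷ is else is) ∣ ≤ 1 + ∣ nat ∋ i ∣ + ∣ list nat ∋ is ∣
  insert≤ true  i is = ≤-refl
  insert≤ false i is = m≤n+m _ (1 + ∣ nat ∋ i ∣)
  step≤ : ∀ b bs i is → Φ bs (memberStep (b , i , is)) ≤ Φ (b ∷ bs) (i , is)
  step≤ b bs i is = begin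
    Φ bs (memberStep (b , i , is)) ≤⟨ +-mono-≤ (s≤s (+-mono-≤ (pred≤ i) (insert≤ b i is)))
                                               (*-monoʳ-≤ (length bs) (s≤s (pred≤ i))) ⟩
    1 + (x + (1 + x + y)) + length bs * (1 + x) ≡⟨ lemma x y (length bs) ⟩
    Φ (b ∷ bs) (i , is)            ∎
    where
    open ≤-Reasoning
    x = ∣ nat ∋ i ∣
    y = ∣ list nat ∋ is ∣
    lemma : ∀ x y n → 1 + (x + (1 + x + y)) + n * (1 + x) ≡ 1 + x + y + suc n * (1 + x)
    lemma = solve-∀

literalᵗ clauseᵗ stateᵗ sm2ᵗ naeᵗ : Ty
literalᵗ = bool ⊗ nat
clauseᵗ  = list literalᵗ ⊗ bin ⊗ bin
stateᵗ   = list (bin ⊗ bin) ⊗ list nat ⊗ list literalᵗ ⊗ bin ⊗ bin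
sm2ᵗ     = list (bin ⊗ bin) ⊗ list (list bool)
naeᵗ     = nat ⊗ list clauseᵗ

-- A binary tree over the sign patterns. `P` and `N` collect the weights with positive and with
-- negative sign, so `P ∸ N` at a leaf is the positive part of the signed sum.
rawClauses : ℕ → ⟦ stateᵗ ⟧ → ⟦ list clauseᵗ ⟧
rawClauses zero    (qs , is , ls , P , N) = (ls , P ∸ N , 1) ∷ []
rawClauses (suc k) (qs , is , ls , P , N) =
  rawClauses k (qs , tail is , (true  , headOr 0 is) ∷ ls , P + weightOf qs (headOr 0 is) , N) ++
  rawClauses k (qs , tail is , (false , headOr 0 is) ∷ ls , P , N + weightOf qs (headOr 0 is))

rawReduction : ℕ → ⟦ sm2ᵗ ⟧ → ⟦ naeᵗ ⟧
rawReduction r (qs , Ss) = suc (length qs) ,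
  foldr (λ S cs → rawClauses r (qs , members (length qs) S , [] , 0 , 0) ++ cs) [] Ss

-- The recursion on `k` unfolds while the program is built. The program contains 2 ^ k leaf
-- routines, a constant number because r is fixed.
rawClausesᵖ : ∀ k → PolyTime stateᵗ (list clauseᵗ) (rawClauses k)
rawClausesᵖ zero    = pairᵖ (fstᵖ (sndᵖ (sndᵖ idᵖ)))
  (pairᵖ (fstᵖ (sndᵖ (sndᵖ (sndᵖ idᵖ))) ∸ᵖ sndᵖ (sndᵖ (sndᵖ (sndᵖ idᵖ)))) (constᵖ 1)) ∷ᵖ constᵖ []
rawClausesᵖ (suc k) =
  applyᵖ (rawClausesᵖ k) (pairᵖ qs (pairᵖ (tailᵖ is)
    (pairᵖ (pairᵖ (constᵖ true) i ∷ᵖ ls) (pairᵖ (P +ᵖ x) N)))) ++ᵖ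
  applyᵖ (rawClausesᵖ k) (pairᵖ qs (pairᵖ (tailᵖ is)
    (pairᵖ (pairᵖ (constᵖ false) i ∷ᵖ ls) (pairᵖ P (N +ᵖ x)))))
  where
  qs = fstᵖ {stateᵗ} idᵖ
  is = fstᵖ {stateᵗ} (sndᵖ idᵖ)
  ls = fstᵖ {stateᵗ} (sndᵖ (sndᵖ idᵖ))
  P  = fstᵖ {stateᵗ} (sndᵖ (sndᵖ (sndᵖ idᵖ)))
  N  = sndᵖ {stateᵗ} (sndᵖ (sndᵖ (sndᵖ idᵖ)))
  -- The head of an exhausted list is `leaf`, the code of the dummy variable 0, so padding comes for
  -- free.
  i  = headOrᵖ {d = 0} refl is
  x  = if-natᵖ i (scaleᵖ i qs) (constᵖ 0)

rawReductionᵖ : ∀ r → PolyTime sm2ᵗ naeᵗ (rawReduction r)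
rawReductionᵖ r = pairᵖ (suc-natᵖ (lengthᵖ (fstᵖ idᵖ)))
  (foldr-additiveᵖ (sndᵖ idᵖ) (constᵖ [])
    (applyᵖ new (pairᵖ envᵖ eltᵖ) ++ᵖ accᵖ)
    ∣ list clauseᵗ ∋_∣ 1 (λ γ → ∣ list clauseᵗ ∋ f γ ∣) (λ _ → ≤-refl)
    (λ n → ≤-trans (n≤1+n _) (≤-reflexive (sym (*-identityˡ _))))
    (size-bounded new) (λ γ S cs → size-++ (f (γ , S)) cs))
  where
  f : ⟦ sm2ᵗ ⊗ list bool ⟧ → ⟦ list clauseᵗ ⟧
  f ((qs , _) , S) = rawClauses r (qs , members (length qs) S , [] , 0 , 0)
  new : PolyTime (sm2ᵗ ⊗ list bool) (list clauseᵗ) f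
  new = applyᵖ (rawClausesᵖ r) (pairᵖ qs (pairᵖ (membersᵖ (lengthᵖ qs) (sndᵖ idᵖ)) (constᵖ ([] , 0 , 0))))
    where qs = fstᵖ (fstᵖ idᵖ)
  size-++ : ∀ xs ys → ∣ list clauseᵗ ∋ xs ++ ys ∣ ≤ ∣ list clauseᵗ ∋ xs ∣ + ∣ list clauseᵗ ∋ ys ∣
  size-++ []       ys = n≤1+n _
  size-++ (x ∷ xs) ys = s≤s (≤-trans (+-monoʳ-≤ ∣ clauseᵗ ∋ x ∣ (size-++ xs ys))
                                     (≤-reflexive (sym (+-assoc ∣ clauseᵗ ∋ x ∣ _ _))))

-- Correctness of the reduction

-- Built directly in lowest terms, so that numerator n and denominator 1 are found by computation
-- and match the weights written by the program.
⌜_⌝ : ℕ → ℚ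
⌜ n ⌝ = mkℚ (ℤ.+ n) 0 (Coprimality.sym (Coprimality.1-coprimeTo n))

⌜⌝-mono-≤ : ∀ {m n} → m ≤ n → ⌜ m ⌝ ℚ.≤ ⌜ n ⌝
⌜⌝-mono-≤ m≤n = ℚ.*≤* (ℤ.*-monoʳ-≤-nonNeg (ℤ.+ 1) (ℤ.+≤+ m≤n))

⌜⌝-cancel-≤ : ∀ {m n} → ⌜ m ⌝ ℚ.≤ ⌜ n ⌝ → m ≤ n
⌜⌝-cancel-≤ {m} {n} (ℚ.*≤* p) = ℤ.drop‿+≤+ (ℤ.*-cancelʳ-≤-pos (ℤ.+ m) (ℤ.+ n) (ℤ.+ 1) p)

⌜⌝-+ : ∀ m n → ⌜ m + n ⌝ ≡ ⌜ m ⌝ ℚ.+ ⌜ n ⌝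
⌜⌝-+ m n = ℚ.toℚᵘ-injective (ℚᵘ.≃-trans (ℚᵘ.*≡* (cong (ℤ._* ℤ.+ 1) (sym
    (cong₂ ℤ._+_ (ℤ.*-identityʳ (ℤ.+ m)) (ℤ.*-identityʳ (ℤ.+ n))))))
  (ℚᵘ.≃-sym (ℚ.toℚᵘ-homo-+ ⌜ m ⌝ ⌜ n ⌝)))

⌜⌝-* : ∀ m n → ⌜ m * n ⌝ ≡ ⌜ m ⌝ ℚ.* ⌜ n ⌝
⌜⌝-* m n = ℚ.toℚᵘ-injective (ℚᵘ.≃-trans (ℚᵘ.*≡* (cong (ℤ._* ℤ.+ 1) (ℤ.pos-* m n)))
  (ℚᵘ.≃-sym (ℚ.toℚᵘ-homo-* ⌜ m ⌝ ⌜ n ⌝)))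

⌜⌝-⊔ : ∀ m n → ⌜ m ⊔ n ⌝ ≡ ⌜ m ⌝ ℚ.⊔ ⌜ n ⌝
⌜⌝-⊔ m n with ≤-total m n
... | inj₁ m≤n = trans (cong ⌜_⌝ (m≤n⇒m⊔n≡n m≤n)) (sym (ℚ.p≤q⇒p⊔q≡q (⌜⌝-mono-≤ m≤n)))
... | inj₂ n≤m = trans (cong ⌜_⌝ (m≥n⇒m⊔n≡m n≤m)) (sym (ℚ.p≥q⇒p⊔q≡p (⌜⌝-mono-≤ n≤m)))

⌜numerator⌝ : ∀ q → 0ℚ ℚ.≤ q → ⌜ ℤ.∣ ↥ q ∣ ⌝ ≡ ⌜ ↧ₙ q ⌝ ℚ.* q
⌜numerator⌝ q@(mkℚ (ℤ.+ a) d _) _ = ℚ.toℚᵘ-injective (ℚᵘ.≃-trans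
  (ℚᵘ.*≡* (trans (ℤ.*-comm (ℤ.+ a) (ℤ.+ (1 * suc d)))
    (trans (cong (λ n → ℤ.+ n ℤ.* ℤ.+ a) (*-identityˡ (suc d))) (sym (ℤ.*-identityʳ (ℤ.+ suc d ℤ.* ℤ.+ a))))))
  (ℚᵘ.≃-sym (ℚ.toℚᵘ-homo-* ⌜ suc d ⌝ q)))
⌜numerator⌝ (mkℚ ℤ.-[1+ _ ] _ _) (ℚ.*≤* ())

-- Weights of the clauses of one scenario

toVec : ∀ {A : Set} {r} (xs : List A) → length xs ≡ r → Vec A r
toVec xs refl = fromList xs

toList-toVec : ∀ {A : Set} {r} (xs : List A) (eq : length xs ≡ r) → toList (toVec xs eq) ≡ xs
toList-toVec xs refl = toList∘fromList xs

clause : ∀ {n r} → Vec (Literal n) r → ℕ → Clause n r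
clause ls w = record { literals = ls ; weight = ⌜ w ⌝ ; weight≥0 = ⌜⌝-mono-≤ z≤n }

hasValue : ∀ {n} → Bool → Vec Bool n → List (Literal n) → Bool
hasValue b α []       = false
hasValue b α (ℓ ∷ ls) = does (evalLiteral α ℓ ≟ᵇ b) ∨ hasValue b α ls

does-any? : ∀ {n r} b (α : Vec Bool n) (ls : Vec (Literal n) r) →
            does (any? (λ ℓ → evalLiteral α ℓ ≟ᵇ b) ls) ≡ hasValue b α (toList ls)
does-any? b α []       = refl
does-any? b α (ℓ ∷ ls) = cong (does (evalLiteral α ℓ ≟ᵇ b) ∨_) (does-any? b α ls)

partSum : ∀ {n} → (Fin (suc n) → ℕ) → ℕ → List (Fin (suc n)) → ℕ
partSum g zero    is = 0
partSum g (suc k) is = g (headOr zero is) + partSum g k (tail is)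

sumList-++ : ∀ ps qs → sumList (ps ++ qs) ≡ sumList ps ℚ.+ sumList qs
sumList-++ []       qs = sym (ℚ.+-identityˡ _)
sumList-++ (p ∷ ps) qs = trans (cong (p ℚ.+_) (sumList-++ ps qs)) (sym (ℚ.+-assoc p _ _))

satisfied : ∀ {n r} → Vec Bool n → Clause n r → ℚ
satisfied α C = if does (satisfied? α C) then Clause.weight C else 0ℚ

private
  hasValue-∨ : ∀ {n} (α : Vec Bool n) ℓ ls → hasValue true α (ℓ ∷ ls) ∨ hasValue false α (ℓ ∷ ls) ≡ true
  hasValue-∨ α ℓ ls with evalLiteral α ℓ
  ... | true  = refl
  ... | false with hasValue true α ls
  ...   | true  = refl
  ...   | false = refl

private
  -- Adding the equations cancels `v` and `v′` and leaves 2 u = 2 u′ + e + g.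
  two-differences : ∀ u u′ v v′ {e g} → u + v ≡ u′ + v′ + e → u + v′ ≡ u′ + v + g → e + g ≤ 2 * u
  two-differences u u′ v v′ {e} {g} p q = +-cancelˡ-≤ (v + v′) _ _ (begin
    v + v′ + (e + g)                  ≤⟨ m≤n+m _ (2 * u′) ⟩
    2 * u′ + (v + v′ + (e + g))       ≡⟨ lemma u′ v v′ e g ⟩
    (u′ + v′ + e) + (u′ + v + g)      ≡⟨ cong₂ _+_ p q ⟨
    (u + v) + (u + v′)                ≡⟨ lemma′ u v v′ ⟩
    v + v′ + 2 * u                    ∎)
    where
    open ≤-Reasoning
    lemma : ∀ u′ v v′ e g → 2 * u′ + (v + v′ + (e + g)) ≡ (u′ + v′ + e) + (u′ + v + g)
    lemma = solve-∀
    lemma′ : ∀ u v v′ → (u + v) + (u + v′) ≡ v + v′ + 2 * u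
    lemma′ = solve-∀

  -- With U = u - u′ and V = v - v′ the left side consists of the positive and negative parts of U +
  -- V and U - V. It equals |U + V| + |U - V| = 2 max(|U|, |V|); the cases fix the signs of U + V
  -- and U - V.
  four-differences : ∀ u u′ v v′ →
    (u + v ∸ (u′ + v′) + (u + v′ ∸ (u′ + v))) + (u′ + v′ ∸ (u + v) + (u′ + v ∸ (u + v′)))
    ≤ 2 * ((u + u′) ⊔ (v + v′))
  four-differences u u′ v v′ with ≤-total (u′ + v′) (u + v) | ≤-total (u′ + v) (u + v′)
  ... | inj₁ p | inj₁ q rewrite m≤n⇒m∸n≡0 p | m≤n⇒m∸n≡0 q = ≤-trans
    (≤-reflexive (+-identityʳ _))
    (≤-trans (two-differences u u′ v v′ (sym (m+[n∸m]≡n p)) (sym (m+[n∸m]≡n q)))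
             (*-monoʳ-≤ 2 (≤-trans (m≤m+n u u′) (m≤m⊔n _ _))))
  ... | inj₁ p | inj₂ q rewrite m≤n⇒m∸n≡0 p | m≤n⇒m∸n≡0 q = ≤-trans
    (≤-reflexive (cong (_+ (u′ + v ∸ (u + v′))) (+-identityʳ _)))
    (≤-trans (two-differences v v′ u u′
                (trans (+-comm v u) (trans (sym (m+[n∸m]≡n p)) (cong (_+ (u + v ∸ (u′ + v′))) (+-comm u′ v′))))
                (trans (+-comm v u′) (trans (sym (m+[n∸m]≡n q)) (cong (_+ (u′ + v ∸ (u + v′))) (+-comm u v′)))))
             (*-monoʳ-≤ 2 (≤-trans (m≤m+n v v′) (m≤n⊔m (u + u′) _))))
  ... | inj₂ p | inj₁ q rewrite m≤n⇒m∸n≡0 p | m≤n⇒m∸n≡0 q = ≤-trans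
    (≤-reflexive (trans (cong (λ k → (u + v′ ∸ (u′ + v)) + k) (+-identityʳ _)) (+-comm (u + v′ ∸ (u′ + v)) (u′ + v′ ∸ (u + v)))))
    (≤-trans (two-differences v′ v u′ u
                (trans (+-comm v′ u′) (trans (sym (m+[n∸m]≡n p)) (cong (_+ (u′ + v′ ∸ (u + v))) (+-comm u v))))
                (trans (+-comm v′ u) (trans (sym (m+[n∸m]≡n q)) (cong (_+ (u + v′ ∸ (u′ + v))) (+-comm u′ v)))))
             (*-monoʳ-≤ 2 (≤-trans (m≤n+m v′ v) (m≤n⊔m (u + u′) _))))
  ... | inj₂ p | inj₂ q rewrite m≤n⇒m∸n≡0 p | m≤n⇒m∸n≡0 q =
    ≤-trans (two-differences u′ u v′ v (sym (m+[n∸m]≡n p)) (sym (m+[n∸m]≡n q)))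
            (*-monoʳ-≤ 2 (≤-trans (m≤n+m u′ u) (m≤m⊔n _ _)))

  swap : ∀ a w b → a + w + b ≡ a + b + w
  swap = solve-∀

  move : ∀ a b w t → a + w + b + t ≡ a + b + (w + t)
  move = solve-∀

  move′ : ∀ a b w t → a + (b + w) + t ≡ a + b + (w + t)
  move′ = solve-∀

  twice : ∀ a m → a * m + a * m ≡ 2 * a * m
  twice = solve-∀

module _ {n : ℕ} (x : Fin (suc n) → ℕ) where

  -- Mirrors the recursion of `rawClauses`; the equation on lengths guarantees exactly r literals at
  -- every leaf.
  clauses : ∀ {r} k (is : List (Fin (suc n))) (ls : List (Literal (suc n))) →
            k + length ls ≡ r → ℕ → ℕ → List (Clause (suc n) r)
  clauses zero    is ls eq P N = clause (toVec ls eq) (P ∸ N) ∷ []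
  clauses (suc k) is ls eq P N =
    clauses k (tail is) (pos i ∷ ls) eq′ (P + x i) N ++
    clauses k (tail is) (neg i ∷ ls) eq′ P (N + x i)
    where
    i = headOr zero is
    eq′ = trans (+-suc k (length ls)) eq

  totalWeight : ℕ → List (Fin (suc n)) → ℕ → ℕ → ℕ
  totalWeight zero    is P N = P ∸ N
  totalWeight (suc k) is P N = totalWeight k (tail is) (P + x (headOr zero is)) N
                             + totalWeight k (tail is) P (N + x (headOr zero is))

  satWeight : Vec Bool (suc n) → ℕ → List (Fin (suc n)) → List (Literal (suc n)) → ℕ → ℕ → ℕ
  satWeight α zero    is ls P N = if hasValue true α ls ∧ hasValue false α ls then P ∸ N else 0
  satWeight α (suc k) is ls P N =
    satWeight α k (tail is) (pos i ∷ ls) (P + x i) N + satWeight α k (tail is) (neg i ∷ ls) P (N + x i)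
    where i = headOr zero is

  trueWeight falseWeight : Vec Bool (suc n) → Fin (suc n) → ℕ
  trueWeight  α i = if lookup α i then x i else 0
  falseWeight α i = if lookup α i then 0 else x i

  satisfied-clauses : ∀ {r} (α : Vec Bool (suc n)) k is ls (eq : k + length ls ≡ r) P N →
    sumList (map (satisfied α) (clauses k is ls eq P N)) ≡ ⌜ satWeight α k is ls P N ⌝
  satisfied-clauses α zero is ls eq P N = trans (ℚ.+-identityʳ _)
    (trans (cong₂ (λ s t → if s ∧ t then ⌜ P ∸ N ⌝ else 0ℚ) (value-of true) (value-of false))
           (lemma (hasValue true α ls ∧ hasValue false α ls)))
    where
    value-of : ∀ b → does (any? (λ ℓ → evalLiteral α ℓ ≟ᵇ b) (toVec ls eq)) ≡ hasValue b α ls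
    value-of b = trans (does-any? b α (toVec ls eq)) (cong (hasValue b α) (toList-toVec ls eq))
    lemma : ∀ b → (if b then ⌜ P ∸ N ⌝ else 0ℚ) ≡ ⌜ if b then P ∸ N else 0 ⌝
    lemma true  = refl
    lemma false = ℚ.≃⇒≡ (ℚ.*≡* refl)
  satisfied-clauses α (suc k) is ls eq P N = begin
    sumList (map (satisfied α) (cs ++ cs′))     ≡⟨ cong sumList (map-++ (satisfied α) cs cs′) ⟩
    sumList (map (satisfied α) cs ++ map (satisfied α) cs′) ≡⟨ sumList-++ (map (satisfied α) cs) _ ⟩
    sumList (map (satisfied α) cs) ℚ.+ sumList (map (satisfied α) cs′) ≡⟨ cong₂ ℚ._+_
      (satisfied-clauses α k (tail is) (pos i ∷ ls) eq′ (P + x i) N)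
      (satisfied-clauses α k (tail is) (neg i ∷ ls) eq′ P (N + x i)) ⟩
    ⌜ s ⌝ ℚ.+ ⌜ t ⌝                            ≡⟨ ⌜⌝-+ s t ⟨
    ⌜ s + t ⌝                                   ∎
    where
    open ≡-Reasoning
    i = headOr zero is
    eq′ = trans (+-suc k (length ls)) eq
    cs  = clauses k (tail is) (pos i ∷ ls) eq′ (P + x i) N
    cs′ = clauses k (tail is) (neg i ∷ ls) eq′ P (N + x i)
    s = satWeight α k (tail is) (pos i ∷ ls) (P + x i) N
    t = satWeight α k (tail is) (neg i ∷ ls) P (N + x i)

  -- The only clause falsified with all literals true is the one whose signs
  -- agree with α, and likewise for all literals false.
  satWeight-total : ∀ (α : Vec Bool (suc n)) k is ls P N → 0 < k + length ls →
    let t = partSum (trueWeight α) k is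
        f = partSum (falseWeight α) k is in
    satWeight α k is ls P N + ((if hasValue false α ls then 0 else (P + t ∸ (N + f)))
                             + (if hasValue true  α ls then 0 else (P + f ∸ (N + t))))
    ≡ totalWeight k is P N
  satWeight-total α zero is ls@(ℓ ∷ ls′) P N _
    rewrite +-identityʳ P | +-identityʳ N
    with hasValue true α ls | hasValue false α ls | hasValue-∨ α ℓ ls′
  ... | true  | true  | _ = +-identityʳ _
  ... | true  | false | _ = +-identityʳ _
  ... | false | true  | _ = refl
  -- A clause without literals would be counted by both correction terms; a literal present is
  -- either true or false.
  ... | false | false | ()
  satWeight-total α (suc k) is ls P N _
    with lookup α (headOr zero is)
       | satWeight-total α k (tail is) (pos (headOr zero is) ∷ ls) (P + x (headOr zero is)) N 0<
       | satWeight-total α k (tail is) (neg (headOr zero is) ∷ ls) P (N + x (headOr zero is)) 0<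
    where
    0< : 0 < k + suc (length ls)
    0< = subst (0 <_) (sym (+-suc k (length ls))) (s≤s z≤n)
  -- For a true variable only the positive branch can stay all true and only the negative branch can
  -- stay all false, so each branch inherits one of the two correction terms.
  ... | true  | ih | ih′ = trans
    (cong₂ (λ p q → s + s′ + ((if hasValue false α ls then 0 else (p ∸ (N + f)))
                            + (if hasValue true α ls then 0 else (P + f ∸ q))))
           (sym (+-assoc P (x (headOr zero is)) t)) (sym (+-assoc N (x (headOr zero is)) t)))
    (trans (regroup s s′ _ _) (cong₂ _+_ ih ih′))
    where
    s  = satWeight α k (tail is) (pos (headOr zero is) ∷ ls) (P + x (headOr zero is)) N
    s′ = satWeight α k (tail is) (neg (headOr zero is) ∷ ls) P (N + x (headOr zero is))
    t  = partSum (trueWeight α) k (tail is)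
    f  = partSum (falseWeight α) k (tail is)
    regroup : ∀ s s′ a b → s + s′ + (a + b) ≡ (s + (a + 0)) + (s′ + (0 + b))
    regroup = solve-∀
  ... | false | ih | ih′ = trans
    (cong₂ (λ p q → s + s′ + ((if hasValue false α ls then 0 else (P + t ∸ q))
                            + (if hasValue true α ls then 0 else (p ∸ (N + t)))))
           (sym (+-assoc P (x (headOr zero is)) f)) (sym (+-assoc N (x (headOr zero is)) f)))
    (trans (regroup s s′ _ _) (cong₂ _+_ ih ih′))
    where
    s  = satWeight α k (tail is) (pos (headOr zero is) ∷ ls) (P + x (headOr zero is)) N
    s′ = satWeight α k (tail is) (neg (headOr zero is) ∷ ls) P (N + x (headOr zero is))
    t  = partSum (trueWeight α) k (tail is)
    f  = partSum (falseWeight α) k (tail is)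
    regroup : ∀ s s′ a b → s + s′ + (a + b) ≡ (s + (0 + b)) + (s′ + (a + 0))
    regroup = solve-∀

  -- Flipping all the signs on one side of the partition permutes the clauses, and
  -- |u + v| + |u - v| = 2 max(|u|, |v|).
  totalWeight-bound : ∀ (α : Vec Bool (suc n)) k is u u′ v v′ →
    let t = partSum (trueWeight α) k is
        f = partSum (falseWeight α) k is in
    (totalWeight k is (u + v) (u′ + v′) + totalWeight k is (u + v′) (u′ + v))
    + (totalWeight k is (u′ + v′) (u + v) + totalWeight k is (u′ + v) (u + v′))
    ≤ 2 ^ k * (2 * ((u + u′ + t) ⊔ (v + v′ + f)))
  totalWeight-bound α zero is u u′ v v′ = begin
    (u + v ∸ (u′ + v′) + (u + v′ ∸ (u′ + v))) + (u′ + v′ ∸ (u + v) + (u′ + v ∸ (u + v′)))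
      ≤⟨ four-differences u u′ v v′ ⟩
    2 * ((u + u′) ⊔ (v + v′))
      ≡⟨ cong₂ (λ a b → 2 * (a ⊔ b)) (+-identityʳ (u + u′)) (+-identityʳ (v + v′)) ⟨
    2 * ((u + u′ + 0) ⊔ (v + v′ + 0))
      ≡⟨ *-identityˡ _ ⟨
    1 * (2 * ((u + u′ + 0) ⊔ (v + v′ + 0))) ∎
    where open ≤-Reasoning
  totalWeight-bound α (suc k) is u u′ v v′
    with lookup α (headOr zero is)
       | totalWeight-bound α k (tail is) (u + x (headOr zero is)) u′ v v′
       | totalWeight-bound α k (tail is) u (u′ + x (headOr zero is)) v v′
       | totalWeight-bound α k (tail is) u u′ (v + x (headOr zero is)) v′
       | totalWeight-bound α k (tail is) u u′ v (v′ + x (headOr zero is))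
  -- `u` and `u′` hold the weights so far of true variables with positive and negative sign, `v` and
  -- `v′` those of false variables. Here `w` joins `u` or `u′`, and the eight branches regroup into
  -- the two corresponding bounds.
  ... | true | p | q | _ | _ = begin
    _ ≡⟨ regroup (T (u + v + w) (u′ + v′)) (T (u + v) (u′ + v′ + w)) (T (u + v′ + w) (u′ + v))
                 (T (u + v′) (u′ + v + w)) (T (u′ + v′ + w) (u + v)) (T (u′ + v′) (u + v + w))
                 (T (u′ + v + w) (u + v′)) (T (u′ + v) (u + v′ + w)) ⟩
    four (u + v + w) (u′ + v′) (u + v′ + w) (u′ + v)
      + four (u + v) (u′ + v′ + w) (u + v′) (u′ + v + w)
      ≡⟨ cong₂ _+_ (cong₂ (λ a c → four a (u′ + v′) c (u′ + v)) (swap u w v) (swap u w v′))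
                   (cong₂ (λ b d → four (u + v) b (u + v′) d) (swap u′ w v′) (swap u′ w v)) ⟨
    four (u + w + v) (u′ + v′) (u + w + v′) (u′ + v)
      + four (u + v) (u′ + w + v′) (u + v′) (u′ + w + v)
      ≤⟨ +-mono-≤ p q ⟩
    2 ^ k * (2 * ((u + w + u′ + t) ⊔ (v + v′ + f))) + 2 ^ k * (2 * ((u + (u′ + w) + t) ⊔ (v + v′ + f)))
      ≡⟨ cong₂ (λ a b → 2 ^ k * (2 * (a ⊔ (v + v′ + f))) + 2 ^ k * (2 * (b ⊔ (v + v′ + f))))
               (move u u′ w t) (move′ u u′ w t) ⟩
    2 ^ k * M + 2 ^ k * M ≡⟨ twice (2 ^ k) M ⟩
    2 * 2 ^ k * M ∎
    where
    open ≤-Reasoning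
    w = x (headOr zero is)
    t = partSum (trueWeight α) k (tail is)
    f = partSum (falseWeight α) k (tail is)
    M = 2 * ((u + u′ + (w + t)) ⊔ (v + v′ + f))
    T : ℕ → ℕ → ℕ
    T = totalWeight k (tail is)
    four : ℕ → ℕ → ℕ → ℕ → ℕ
    four a b c d = (T a b + T c d) + (T b a + T d c)
    regroup : ∀ a b c d e f g h →
      ((a + b) + (c + d)) + ((e + f) + (g + h)) ≡ ((a + c) + (f + h)) + ((b + d) + (e + g))
    regroup = solve-∀
  -- The weight now belongs to V, which has opposite signs in U + V and U - V, so the positive
  -- branch of one is grouped with the negative branch of the other.
  ... | false | _ | _ | p | q = begin
    _ ≡⟨ regroup (T (u + v + w) (u′ + v′)) (T (u + v) (u′ + v′ + w)) (T (u + v′ + w) (u′ + v))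
                 (T (u + v′) (u′ + v + w)) (T (u′ + v′ + w) (u + v)) (T (u′ + v′) (u + v + w))
                 (T (u′ + v + w) (u + v′)) (T (u′ + v) (u + v′ + w)) ⟩
    four (u + v + w) (u′ + v′) (u + v′) (u′ + v + w)
      + four (u + v) (u′ + v′ + w) (u + v′ + w) (u′ + v)
      ≡⟨ cong₂ _+_ (cong₂ (λ a d → four a (u′ + v′) (u + v′) d) (+-assoc u v w) (+-assoc u′ v w))
                   (cong₂ (λ b c → four (u + v) b c (u′ + v)) (+-assoc u′ v′ w) (+-assoc u v′ w)) ⟩
    four (u + (v + w)) (u′ + v′) (u + v′) (u′ + (v + w))
      + four (u + v) (u′ + (v′ + w)) (u + (v′ + w)) (u′ + v)
      ≤⟨ +-mono-≤ p q ⟩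
    2 ^ k * (2 * ((u + u′ + t) ⊔ (v + w + v′ + f))) + 2 ^ k * (2 * ((u + u′ + t) ⊔ (v + (v′ + w) + f)))
      ≡⟨ cong₂ (λ a b → 2 ^ k * (2 * ((u + u′ + t) ⊔ a)) + 2 ^ k * (2 * ((u + u′ + t) ⊔ b)))
               (move v v′ w f) (move′ v v′ w f) ⟩
    2 ^ k * M + 2 ^ k * M ≡⟨ twice (2 ^ k) M ⟩
    2 * 2 ^ k * M ∎
    where
    open ≤-Reasoning
    w = x (headOr zero is)
    t = partSum (trueWeight α) k (tail is)
    f = partSum (falseWeight α) k (tail is)
    M = 2 * ((u + u′ + t) ⊔ (v + v′ + (w + f)))
    T : ℕ → ℕ → ℕ
    T = totalWeight k (tail is)
    four : ℕ → ℕ → ℕ → ℕ → ℕ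
    four a b c d = (T a b + T c d) + (T b a + T d c)
    regroup : ∀ a b c d e f g h →
      ((a + b) + (c + d)) + ((e + f) + (g + h)) ≡ ((a + d) + (f + g)) + ((b + c) + (e + h))
    regroup = solve-∀

-- Scenarios as padded lists of variables

jobs : ∀ {n} → Subset n → List (Fin n)
jobs []          = []
jobs (true  ∷ S) = zero ∷ map suc (jobs S)
jobs (false ∷ S) = map suc (jobs S)

length-jobs : ∀ {n} (S : Subset n) → length (jobs S) ≡ ∣ S ∣
length-jobs []          = refl
length-jobs (true  ∷ S) = cong suc (trans (length-map suc (jobs S)) (length-jobs S))
length-jobs (false ∷ S) = trans (length-map suc (jobs S)) (length-jobs S)

members-jobs : ∀ {n} (S : Subset n) → members n (toList S) ≡ map toℕ (map suc (jobs S))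
members-jobs {n} S = trans (cong proj₂ (go 0 S)) (map-∘ (jobs S))
  where
  -- The offset `k` counts the jobs in front of the current suffix; the counter has come down to it
  -- once the suffix is consumed.
  go : ∀ {n} k (S : Subset n) → foldr (λ b s → memberStep (b , s)) (k + n , []) (toList S)
                                ≡ (k , map (λ j → suc (k + toℕ j)) (jobs S))
  go {n = zero} k [] = cong (_, []) (+-identityʳ k)
  go {n = suc n} k (b ∷ S) rewrite +-suc k n | go (suc k) S = cong (k ,_) (lemma b)
    where
    shift : map (λ j → suc (suc k + toℕ j)) (jobs S) ≡ map (λ j → suc (k + toℕ j)) (map suc (jobs S))
    shift = trans (map-cong (λ j → cong suc (sym (+-suc k (toℕ j)))) (jobs S)) (map-∘ (jobs S))
    lemma : ∀ b → (if b then suc k ∷ map (λ j → suc (suc k + toℕ j)) (jobs S)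
                   else map (λ j → suc (suc k + toℕ j)) (jobs S))
                  ≡ map (λ j → suc (k + toℕ j)) (jobs (b ∷ S))
    lemma true  = cong₂ _∷_ (cong suc (sym (+-identityʳ k))) shift
    lemma false = shift

sum-jobs : ∀ {n} (S : Subset n) (h : Fin n → ℕ) (q : Fin n → ℚ) d → (∀ j → ⌜ h j ⌝ ≡ d ℚ.* q j) →
           ⌜ sum (map h (jobs S)) ⌝ ≡ d ℚ.* ∑ (λ j → if lookup S j then q j else 0ℚ)
sum-jobs []          h q d eq = sym (ℚ.*-zeroʳ d)
sum-jobs (true ∷ S)  h q d eq = begin
  ⌜ h zero + sum (map h (map suc (jobs S))) ⌝        ≡⟨ ⌜⌝-+ (h zero) _ ⟩
  ⌜ h zero ⌝ ℚ.+ ⌜ sum (map h (map suc (jobs S))) ⌝  ≡⟨ cong₂ ℚ._+_ (eq zero)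
     (trans (cong (⌜_⌝ ∘ sum) (sym (map-∘ (jobs S)))) (sum-jobs S (h ∘ suc) (q ∘ suc) d (eq ∘ suc))) ⟩
  d ℚ.* q zero ℚ.+ d ℚ.* _                           ≡⟨ ℚ.*-distribˡ-+ d (q zero) _ ⟨
  d ℚ.* (q zero ℚ.+ _)                               ∎
  where open ≡-Reasoning
sum-jobs (false ∷ S) h q d eq = trans (cong (⌜_⌝ ∘ sum) (sym (map-∘ (jobs S))))
  (trans (sum-jobs S (h ∘ suc) (q ∘ suc) d (eq ∘ suc)) (cong (d ℚ.*_) (sym (ℚ.+-identityˡ _))))

-- The bound on the size of a scenario enters here: all its jobs fit into `k` positions, and the
-- remaining ones hold the dummy of weight 0.
partSum-sum : ∀ {n} (g : Fin (suc n) → ℕ) → g zero ≡ 0 → ∀ k is → length is ≤ k →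
              partSum g k is ≡ sum (map g is)
partSum-sum g g0 zero    []       _       = refl
partSum-sum g g0 (suc k) []       _       = cong₂ _+_ g0 (partSum-sum g g0 k [] z≤n)
partSum-sum g g0 (suc k) (i ∷ is) (s≤s p) = cong (g i +_) (partSum-sum g g0 k is p)

partSum-+ : ∀ {n} (f g h : Fin (suc n) → ℕ) → (∀ i → f i + g i ≡ h i) → ∀ k is →
            partSum f k is + partSum g k is ≡ partSum h k is
partSum-+ f g h eq zero    is = refl
partSum-+ f g h eq (suc k) is = trans (interchange (f i) _ (g i) _)
  (cong₂ _+_ (eq i) (partSum-+ f g h eq k (tail is)))
  where
  i = headOr zero is
  interchange : ∀ a b c d → (a + b) + (c + d) ≡ (a + c) + (b + d)
  interchange = solve-∀

monus+monus : ∀ m n → (m ∸ n) + (n ∸ m) + (m + n) ≡ 2 * (m ⊔ n)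
monus+monus m n with ≤-total m n
... | inj₁ m≤n rewrite m≤n⇒m∸n≡0 m≤n | m≤n⇒m⊔n≡n m≤n =
  trans (sym (+-assoc (n ∸ m) m n)) (trans (cong (_+ n) (m∸n+n≡m m≤n)) (cong (n +_) (sym (+-identityʳ n))))
... | inj₂ n≤m rewrite m≤n⇒m∸n≡0 n≤m | m≥n⇒m⊔n≡m n≤m =
  trans (lemma (m ∸ n) m n) (trans (cong (_+ m) (m∸n+n≡m n≤m)) (cong (m +_) (sym (+-identityʳ m))))
  where lemma : ∀ d m n → d + 0 + (m + n) ≡ d + n + m
        lemma = solve-∀

-- Agreement of plain and typed encodings

encodeList-map : ∀ {A B : Set} (e : B → Tree) (f : A → B) xs →
                 encodeList e (map f xs) ≡ encodeList (e ∘ f) xs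
encodeList-map e f []       = refl
encodeList-map e f (x ∷ xs) = cong (e (f x) ∙_) (encodeList-map e f xs)

encodeList-cong : ∀ {A : Set} {e e′ : A → Tree} → e ≗ e′ → ∀ xs → encodeList e xs ≡ encodeList e′ xs
encodeList-cong eq []       = refl
encodeList-cong eq (x ∷ xs) = cong₂ _∙_ (eq x) (encodeList-cong eq xs)

fraction : ℚ → ℕ × ℕ
fraction q = ℤ.∣ ↥ q ∣ , ↧ₙ q

rawLiteral : ∀ {n} → Literal n → Bool × ℕ
rawLiteral (pos i) = true , toℕ i
rawLiteral (neg i) = false , toℕ i

rawClause : ∀ {n r} → Clause n r → ⟦ clauseᵗ ⟧
rawClause C = map rawLiteral (toList (Clause.literals C)) , fraction (Clause.weight C)

rawNae : ∀ {r} → NaeInstance r → ⟦ naeᵗ ⟧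
rawNae I = NaeInstance.n I , map rawClause (NaeInstance.clauses I)

encode-rawNae : ∀ {r} (I : NaeInstance r) → enc naeᵗ (rawNae I) ≡ NaeInstance.encode I
encode-rawNae I = cong (encodeUnary (NaeInstance.n I) ∙_)
  (trans (encodeList-map (enc clauseᵗ) rawClause (NaeInstance.clauses I))
         (encodeList-cong (λ C → cong (_∙ _)
           (trans (encodeList-map (enc literalᵗ) rawLiteral (toList (Clause.literals C)))
                  (encodeList-cong (λ { (pos _) → refl ; (neg _) → refl }) (toList (Clause.literals C)))))
           (NaeInstance.clauses I)))

rawSM2 : SM2Instance → ⟦ sm2ᵗ ⟧
rawSM2 I = map fraction (tabulate (SM2Instance.p I)) , map toList (SM2Instance.scenarios I)

encode-rawSM2 : ∀ I → enc sm2ᵗ (rawSM2 I) ≡ SM2Instance.encode I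
encode-rawSM2 I = cong₂ _∙_
  (encodeList-map (enc (bin ⊗ bin)) fraction (tabulate (SM2Instance.p I)))
  (encodeList-map (enc (list bool)) toList (SM2Instance.scenarios I))

headOr-map : ∀ {A B : Set} (f : A → B) d xs → headOr (f d) (map f xs) ≡ f (headOr d xs)
headOr-map f d []       = refl
headOr-map f d (x ∷ xs) = refl

tail-map : ∀ {A B : Set} (f : A → B) xs → tail (map f xs) ≡ map f (tail xs)
tail-map f []       = refl
tail-map f (x ∷ xs) = refl

rawClauses-clauses : ∀ {n r} qs k (is : List (Fin (suc n))) ls (eq : k + length ls ≡ r) P N →
  rawClauses k (qs , map toℕ is , map rawLiteral ls , P , N)
  ≡ map rawClause (clauses (weightOf qs ∘ toℕ) k is ls eq P N)
rawClauses-clauses qs zero    is ls eq P N =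
  cong (λ l → (map rawLiteral l , P ∸ N , 1) ∷ []) (sym (toList-toVec ls eq))
rawClauses-clauses qs (suc k) is ls eq P N
  rewrite headOr-map toℕ zero is | tail-map toℕ is = trans
  (cong₂ _++_ (rawClauses-clauses qs k (tail is) (pos (headOr zero is) ∷ ls) _ _ N)
              (rawClauses-clauses qs k (tail is) (neg (headOr zero is) ∷ ls) _ P _))
  (sym (map-++ rawClause (clauses _ k (tail is) (pos (headOr zero is) ∷ ls) _ _ N) _))

-- Exchanging the denominator of `p j` for its numerator multiplies the product of all denominators
-- by `p j`.
⌜scale⌝ : ∀ {n} (p : Fin n → ℚ) → (∀ j → 0ℚ ℚ.≤ p j) → ∀ j →
  ⌜ scale (suc (toℕ j)) (map fraction (tabulate p)) ⌝ ≡ ⌜ scale 0 (map fraction (tabulate p)) ⌝ ℚ.* p j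
⌜scale⌝ p p≥0 zero = begin
  ⌜ a * D ⌝                   ≡⟨ ⌜⌝-* a D ⟩
  ⌜ a ⌝ ℚ.* ⌜ D ⌝             ≡⟨ cong (ℚ._* ⌜ D ⌝) (⌜numerator⌝ (p zero) (p≥0 zero)) ⟩
  ⌜ b ⌝ ℚ.* p zero ℚ.* ⌜ D ⌝  ≡⟨ solve 3 (λ b p D → b :* p :* D := b :* D :* p) refl ⌜ b ⌝ (p zero) ⌜ D ⌝ ⟩
  ⌜ b ⌝ ℚ.* ⌜ D ⌝ ℚ.* p zero  ≡⟨ cong (ℚ._* p zero) (⌜⌝-* b D) ⟨
  ⌜ b * D ⌝ ℚ.* p zero        ∎
  where
  open ≡-Reasoning
  open ℚ.+-*-Solver using (solve; _:*_; _:=_)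
  a = proj₁ (fraction (p zero))
  b = proj₂ (fraction (p zero))
  D = scale 0 (map fraction (tabulate (p ∘ suc)))
⌜scale⌝ p p≥0 (suc j) = begin
  ⌜ b * x ⌝                   ≡⟨ ⌜⌝-* b x ⟩
  ⌜ b ⌝ ℚ.* ⌜ x ⌝             ≡⟨ cong (⌜ b ⌝ ℚ.*_) (⌜scale⌝ (p ∘ suc) (p≥0 ∘ suc) j) ⟩
  ⌜ b ⌝ ℚ.* (⌜ D ⌝ ℚ.* p (suc j)) ≡⟨ ℚ.*-assoc ⌜ b ⌝ ⌜ D ⌝ (p (suc j)) ⟨
  ⌜ b ⌝ ℚ.* ⌜ D ⌝ ℚ.* p (suc j)  ≡⟨ cong (ℚ._* p (suc j)) (⌜⌝-* b D) ⟨
  ⌜ b * D ⌝ ℚ.* p (suc j)        ∎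
  where
  open ≡-Reasoning
  b = proj₂ (fraction (p zero))
  D = scale 0 (map fraction (tabulate (p ∘ suc)))
  x = scale (suc (toℕ j)) (map fraction (tabulate (p ∘ suc)))

scale-positive : ∀ (ps : List ℚ) → 0 < scale 0 (map fraction ps)
scale-positive []       = s≤s z≤n
scale-positive (q ∷ ps) = *-mono-≤ {1} {↧ₙ q} (s≤s z≤n) (scale-positive ps)

if-if : ∀ {A : Set} (s a : Bool) (x z : A) →
        (if s then (if a then x else z) else z) ≡ (if a ∧ s then x else z)
if-if true  true  x z = refl
if-if true  false x z = refl
if-if false true  x z = refl
if-if false false x z = refl

if-if-not : ∀ {A : Set} (s a : Bool) (x z : A) →
            (if s then (if a then z else x) else z) ≡ (if not a ∧ s then x else z)
if-if-not true  true  x z = refl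
if-if-not true  false x z = refl
if-if-not false true  x z = refl
if-if-not false false x z = refl

-- The reduced instance and its values

module Reduction (r : ℕ) .{{_ : NonZero r}} (I : SM2Instance) where
  open SM2Instance I

  qs : List (ℕ × ℕ)
  qs = map fraction (tabulate p)

  D : ℕ
  D = scale 0 qs

  x : Fin (suc n) → ℕ
  x = weightOf qs ∘ toℕ

  variables : Subset n → List (Fin (suc n))
  variables S = map suc (jobs S)

  scenarioClauses : Subset n → List (Clause (suc n) r)
  scenarioClauses S = clauses x r (variables S) [] (+-identityʳ r) 0 0

  allClauses : List (Subset n) → List (Clause (suc n) r)
  allClauses = foldr (λ S cs → scenarioClauses S ++ cs) []

  naeInstance : NaeInstance r
  naeInstance = record { n = suc n ; clauses = allClauses scenarios }

  rawNae-naeInstance : rawReduction r (rawSM2 I) ≡ rawNae naeInstance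
  rawNae-naeInstance = cong₂ _,_ (cong suc n≡) (go scenarios)
    where
    n≡ : length qs ≡ n
    n≡ = trans (length-map fraction (tabulate p)) (length-tabulate p)
    go : ∀ Ss → foldr (λ S cs → rawClauses r (qs , members (length qs) S , [] , 0 , 0) ++ cs) [] (map toList Ss)
                ≡ map rawClause (allClauses Ss)
    go []       = refl
    go (S ∷ Ss) = trans
      (cong₂ _++_ (trans
        (cong (λ is → rawClauses r (qs , is , [] , 0 , 0))
              (trans (cong (λ k → members k (toList S)) n≡) (members-jobs S)))
        (rawClauses-clauses qs r (variables S) [] (+-identityʳ r) 0 0)) (go Ss))
      (sym (map-++ rawClause (scenarioClauses S) (allClauses Ss)))

  module _ (α : Vec Bool (suc n)) where

    sat trueLoad falseLoad scaledMakespan : Subset n → ℕ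
    sat S            = satWeight x α r (variables S) [] 0 0
    trueLoad S       = partSum (trueWeight x α) r (variables S)
    falseLoad S      = partSum (falseWeight x α) r (variables S)
    scaledMakespan S = trueLoad S ⊔ falseLoad S

    satisfiedWeight-sat : NaeInstance.satisfiedWeight naeInstance α ≡ ⌜ sum (map sat scenarios) ⌝
    satisfiedWeight-sat = go scenarios
      where
      go : ∀ Ss → sumList (map (satisfied α) (allClauses Ss)) ≡ ⌜ sum (map sat Ss) ⌝
      go []       = refl
      go (S ∷ Ss) = begin
        sumList (map (satisfied α) (scenarioClauses S ++ allClauses Ss))
          ≡⟨ cong sumList (map-++ (satisfied α) (scenarioClauses S) (allClauses Ss)) ⟩
        sumList (map (satisfied α) (scenarioClauses S) ++ map (satisfied α) (allClauses Ss))
          ≡⟨ sumList-++ (map (satisfied α) (scenarioClauses S)) _ ⟩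
        sumList (map (satisfied α) (scenarioClauses S)) ℚ.+ sumList (map (satisfied α) (allClauses Ss))
          ≡⟨ cong₂ ℚ._+_ (satisfied-clauses x α r (variables S) [] (+-identityʳ r) 0 0) (go Ss) ⟩
        ⌜ sat S ⌝ ℚ.+ ⌜ sum (map sat Ss) ⌝
          ≡⟨ ⌜⌝-+ (sat S) _ ⟨
        ⌜ sat S + sum (map sat Ss) ⌝ ∎
        where open ≡-Reasoning

    totalScenarioWeight constantWeight : Subset n → ℕ
    totalScenarioWeight S = totalWeight x r (variables S) 0 0
    constantWeight S      = totalScenarioWeight S + partSum x r (variables S)

    sat-totalWeight : ∀ S →
      sat S + ((trueLoad S ∸ falseLoad S) + (falseLoad S ∸ trueLoad S)) ≡ totalScenarioWeight S
    sat-totalWeight S = satWeight-total x α r (variables S) [] 0 0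
      (≤-trans (>-nonZero⁻¹ r) (m≤m+n r 0))

    sat+makespan : ∀ S → sat S + 2 * scaledMakespan S ≡ constantWeight S
    sat+makespan S = begin
      sat S + 2 * (t ⊔ f)                             ≡⟨ cong (sat S +_) (monus+monus t f) ⟨
      sat S + ((t ∸ f) + (f ∸ t) + (t + f))           ≡⟨ +-assoc (sat S) _ _ ⟨
      sat S + ((t ∸ f) + (f ∸ t)) + (t + f)           ≡⟨ cong₂ _+_ (sat-totalWeight S)
        (partSum-+ (trueWeight x α) (falseWeight x α) x split r (variables S)) ⟩
      constantWeight S                                ∎
      where
      open ≡-Reasoning
      t = trueLoad S
      f = falseLoad S
      split : ∀ i → trueWeight x α i + falseWeight x α i ≡ x i
      split i with lookup α i
      ... | true  = +-identityʳ (x i)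
      ... | false = refl

    -- Satisfied weight is at most total weight, and the latter can be bounded using the partition
    -- of any assignment, in particular `α` itself.
    sat≤makespan : ∀ S → 2 * sat S ≤ 2 ^ r * scaledMakespan S
    sat≤makespan S = *-cancelˡ-≤ 2 (begin
      2 * (2 * sat S)              ≤⟨ *-monoʳ-≤ 2 (*-monoʳ-≤ 2 (≤-trans (m≤m+n (sat S) _) (≤-reflexive (sat-totalWeight S)))) ⟩
      2 * (2 * T)                  ≡⟨ lemma T ⟩
      -- With all four partial sums 0, the four terms of the bound coincide.
      (T + T) + (T + T)            ≤⟨ totalWeight-bound x α r (variables S) 0 0 0 0 ⟩
      2 ^ r * (2 * scaledMakespan S) ≡⟨ lemma′ (2 ^ r) (scaledMakespan S) ⟩
      2 * (2 ^ r * scaledMakespan S) ∎)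
      where
      open ≤-Reasoning
      T = totalScenarioWeight S
      lemma : ∀ T → 2 * (2 * T) ≡ (T + T) + (T + T)
      lemma = solve-∀
      lemma′ : ∀ a m → a * (2 * m) ≡ 2 * (a * m)
      lemma′ = solve-∀

  totalSat totalScaledMakespan : Vec Bool (suc n) → ℕ
  totalSat            α = sum (map (sat α) scenarios)
  totalScaledMakespan α = sum (map (scaledMakespan α) scenarios)

  sat+makespan-constant : ∀ α β → totalSat α + 2 * totalScaledMakespan α
                                ≡ totalSat β + 2 * totalScaledMakespan β
  sat+makespan-constant α β = go scenarios
    where
    interchange : ∀ a b c d → a + b + 2 * (c + d) ≡ (a + 2 * c) + (b + 2 * d)
    interchange = solve-∀
    go : ∀ Ss → sum (map (sat α) Ss) + 2 * sum (map (scaledMakespan α) Ss)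
              ≡ sum (map (sat β) Ss) + 2 * sum (map (scaledMakespan β) Ss)
    go []       = refl
    go (S ∷ Ss) = trans (interchange (sat α S) _ (scaledMakespan α S) _) (trans
      -- `constantWeight` does not mention the assignment, so its versions for `α` and `β` agree by
      -- computation.
      (cong₂ _+_ (trans (sat+makespan α S) (sym (sat+makespan β S))) (go Ss))
      (sym (interchange (sat β S) _ (scaledMakespan β S) _)))

  totalSat≤ : ∀ α → 2 * totalSat α ≤ 2 ^ r * totalScaledMakespan α
  totalSat≤ α = go scenarios
    where
    go : ∀ Ss → 2 * sum (map (sat α) Ss) ≤ 2 ^ r * sum (map (scaledMakespan α) Ss)
    go []       = z≤n
    go (S ∷ Ss) = begin
      2 * (sat α S + sum (map (sat α) Ss))       ≡⟨ *-distribˡ-+ 2 (sat α S) _ ⟩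
      2 * sat α S + 2 * sum (map (sat α) Ss)     ≤⟨ +-mono-≤ (sat≤makespan α S) (go Ss) ⟩
      2 ^ r * scaledMakespan α S + 2 ^ r * sum (map (scaledMakespan α) Ss) ≡⟨ *-distribˡ-+ (2 ^ r) (scaledMakespan α S) _ ⟨
      2 ^ r * (scaledMakespan α S + sum (map (scaledMakespan α) Ss)) ∎
      where open ≤-Reasoning

  -- `b` is the value of the dummy variable, which adds 0 to either load.
  module _ (small : All (λ S → ∣ S ∣ ≤ r) scenarios) (b : Bool) (A : Subset n) where

    private
      ⌜if⌝ : ∀ c k q → ⌜ k ⌝ ≡ ⌜ D ⌝ ℚ.* q → ⌜ if c then k else 0 ⌝ ≡ ⌜ D ⌝ ℚ.* (if c then q else 0ℚ)
      ⌜if⌝ true  k q eq = eq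
      ⌜if⌝ false k q eq = sym (ℚ.*-zeroʳ ⌜ D ⌝)

      ⌜if⌝′ : ∀ c k q → ⌜ k ⌝ ≡ ⌜ D ⌝ ℚ.* q → ⌜ if c then 0 else k ⌝ ≡ ⌜ D ⌝ ℚ.* (if c then 0ℚ else q)
      ⌜if⌝′ true  k q eq = sym (ℚ.*-zeroʳ ⌜ D ⌝)
      ⌜if⌝′ false k q eq = eq

      part-load : ∀ (g : Fin (suc n) → ℕ) (q : Fin n → ℚ) → g zero ≡ 0 →
        (∀ j → ⌜ g (suc j) ⌝ ≡ ⌜ D ⌝ ℚ.* q j) → ∀ S → ∣ S ∣ ≤ r →
        ⌜ partSum g r (variables S) ⌝ ≡ ⌜ D ⌝ ℚ.* ∑ (λ j → if lookup S j then q j else 0ℚ)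
      part-load g q g0 eq S S≤r = trans
        (cong ⌜_⌝ (trans (partSum-sum g g0 r (variables S)
                     (subst (_≤ r) (sym (trans (length-map suc (jobs S)) (length-jobs S))) S≤r))
                   (cong sum (sym (map-∘ (jobs S))))))
        (sum-jobs S (g ∘ suc) q ⌜ D ⌝ eq)

      zero-if : ∀ c → (if c then 0 else 0) ≡ 0
      zero-if true  = refl
      zero-if false = refl

    ⌜trueLoad⌝ : ∀ S → ∣ S ∣ ≤ r → ⌜ trueLoad (b ∷ A) S ⌝ ≡ ⌜ D ⌝ ℚ.* load (A ∩ S)
    ⌜trueLoad⌝ S S≤r = trans
      (part-load (trueWeight x (b ∷ A)) (λ j → if lookup A j then p j else 0ℚ) (zero-if b)
        (λ j → ⌜if⌝ (lookup A j) _ _ (⌜scale⌝ p p≥0 j)) S S≤r)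
      (cong (⌜ D ⌝ ℚ.*_) (sum-cong-≗ λ j → trans (if-if (lookup S j) (lookup A j) (p j) 0ℚ)
        (cong (λ c → if c then p j else 0ℚ) (sym (lookup-zipWith _∧_ j A S)))))

    ⌜falseLoad⌝ : ∀ S → ∣ S ∣ ≤ r → ⌜ falseLoad (b ∷ A) S ⌝ ≡ ⌜ D ⌝ ℚ.* load (∁ A ∩ S)
    ⌜falseLoad⌝ S S≤r = trans
      (part-load (falseWeight x (b ∷ A)) (λ j → if lookup A j then 0ℚ else p j) (zero-if b)
        (λ j → ⌜if⌝′ (lookup A j) _ _ (⌜scale⌝ p p≥0 j)) S S≤r)
      (cong (⌜ D ⌝ ℚ.*_) (sum-cong-≗ λ j → trans (if-if-not (lookup S j) (lookup A j) (p j) 0ℚ)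
        (cong (λ c → if c then p j else 0ℚ) (sym (trans (lookup-zipWith _∧_ j (∁ A) S)
          (cong (_∧ lookup S j) (lookup-map j not A)))))))

    ⌜totalScaledMakespan⌝ : ⌜ totalScaledMakespan (b ∷ A) ⌝ ≡ ⌜ D ⌝ ℚ.* totalMakespan A
    ⌜totalScaledMakespan⌝ = go scenarios small
      where
      go : ∀ Ss → All (λ S → ∣ S ∣ ≤ r) Ss →
           ⌜ sum (map (scaledMakespan (b ∷ A)) Ss) ⌝ ≡ ⌜ D ⌝ ℚ.* sumList (map (makespan A) Ss)
      go []       []              = sym (ℚ.*-zeroʳ ⌜ D ⌝)
      go (S ∷ Ss) (S≤r ∷ small′) = begin
        ⌜ t ⊔ f + sum (map (scaledMakespan (b ∷ A)) Ss) ⌝           ≡⟨ ⌜⌝-+ (t ⊔ f) _ ⟩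
        ⌜ t ⊔ f ⌝ ℚ.+ ⌜ sum (map (scaledMakespan (b ∷ A)) Ss) ⌝     ≡⟨ cong₂ ℚ._+_
          (trans (⌜⌝-⊔ t f) (trans (cong₂ ℚ._⊔_ (⌜trueLoad⌝ S S≤r) (⌜falseLoad⌝ S S≤r))
             (sym (ℚ.*-distribˡ-⊔-nonNeg ⌜ D ⌝ (load (A ∩ S)) (load (∁ A ∩ S)))))) (go Ss small′) ⟩
        ⌜ D ⌝ ℚ.* makespan A S ℚ.+ ⌜ D ⌝ ℚ.* sumList (map (makespan A) Ss)
          ≡⟨ ℚ.*-distribˡ-+ ⌜ D ⌝ (makespan A S) _ ⟨
        ⌜ D ⌝ ℚ.* (makespan A S ℚ.+ sumList (map (makespan A) Ss))  ∎
        where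
        open ≡-Reasoning
        t = trueLoad (b ∷ A) S
        f = falseLoad (b ∷ A) S

-- From satisfied weight to the approximation ratio

⌜⌝-positive : ∀ {n} → 0 < n → ℚ.Positive ⌜ n ⌝
⌜⌝-positive {suc n} _ = _

-- Clearing the denominator 4 keeps the estimate integral and treats r = 1, where the factor is 1/2,
-- like the other cases.
⌜4⌝*2^[-2] : ∀ r → ⌜ 4 ⌝ ℚ.* 2^[ r -2] ≡ ⌜ 2 ^ r ⌝
⌜4⌝*2^[-2] r = ℚ.toℚᵘ-injective (ℚᵘ.≃-trans (ℚ.toℚᵘ-homo-* ⌜ 4 ⌝ 2^[ r -2])
  (ℚᵘ.≃-trans (ℚᵘ.*-congˡ {toℚᵘ ⌜ 4 ⌝} (ℚ.toℚᵘ-fromℚᵘ (ℚᵘ.mkℚᵘ (ℤ.+ (2 ^ r)) 3)))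
              (ℚᵘ.*≡* (trans (ℤ.*-identityʳ _) (ℤ.*-comm (ℤ.+ 4) (ℤ.+ (2 ^ r)))))))

-- The constant sum turns the loss in satisfied weight into 2 m ≤ g s* + 2 m*. Doubling and
-- inserting 2 s* ≤ a m* with a = 4 c gives 4 m ≤ 4 (1 + c g) m*.
makespan-bound : ∀ s s* m m* a (c g : ℚ) → 0ℚ ℚ.≤ g → (1ℚ ℚ.- g) ℚ.* ⌜ s* ⌝ ℚ.≤ ⌜ s ⌝ →
  s + 2 * m ≡ s* + 2 * m* → 2 * s* ≤ a * m* → ⌜ 4 ⌝ ℚ.* c ≡ ⌜ a ⌝ →
  ⌜ m ⌝ ℚ.≤ (1ℚ ℚ.+ c ℚ.* g) ℚ.* ⌜ m* ⌝
makespan-bound s s* m m* a c g g≥0 approx eq s*≤ 4c≡a = ℚ.*-cancelˡ-≤-pos ⌜ 4 ⌝ (begin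
  ⌜ 4 ⌝ ℚ.* M                                     ≡⟨ ℚ.*-assoc ⌜ 2 ⌝ ⌜ 2 ⌝ M ⟩
  ⌜ 2 ⌝ ℚ.* (⌜ 2 ⌝ ℚ.* M)                         ≤⟨ ℚ.*-monoˡ-≤-nonNeg ⌜ 2 ⌝ 2M≤ ⟩
  ⌜ 2 ⌝ ℚ.* (g ℚ.* S* ℚ.+ ⌜ 2 ⌝ ℚ.* M*)           ≡⟨ solve 4 (λ w g S M → w :* (g :* S :+ w :* M) := g :* (w :* S) :+ w :* w :* M) refl ⌜ 2 ⌝ g S* M* ⟩
  g ℚ.* (⌜ 2 ⌝ ℚ.* S*) ℚ.+ ⌜ 4 ⌝ ℚ.* M*           ≤⟨ ℚ.+-monoˡ-≤ (⌜ 4 ⌝ ℚ.* M*) (ℚ.*-monoˡ-≤-nonNeg g {{ℚ.nonNegative g≥0}} 2S*≤) ⟩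
  g ℚ.* (⌜ a ⌝ ℚ.* M*) ℚ.+ ⌜ 4 ⌝ ℚ.* M*           ≡⟨ cong (λ q → g ℚ.* (q ℚ.* M*) ℚ.+ ⌜ 4 ⌝ ℚ.* M*) 4c≡a ⟨
  g ℚ.* (⌜ 4 ⌝ ℚ.* c ℚ.* M*) ℚ.+ ⌜ 4 ⌝ ℚ.* M*     ≡⟨ solve 4 (λ f c g M → g :* (f :* c :* M) :+ f :* M := f :* ((con 1ℚ :+ c :* g) :* M)) refl ⌜ 4 ⌝ c g M* ⟩
  ⌜ 4 ⌝ ℚ.* ((1ℚ ℚ.+ c ℚ.* g) ℚ.* M*)             ∎)
  where
  open ℚ.≤-Reasoning
  open ℚ.+-*-Solver using (solve; _:*_; _:+_; _:=_; :-_; con)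
  S = ⌜ s ⌝
  S* = ⌜ s* ⌝
  M = ⌜ m ⌝
  M* = ⌜ m* ⌝
  ⌜+2*⌝ : ∀ s m → ⌜ s + 2 * m ⌝ ≡ ⌜ s ⌝ ℚ.+ ⌜ 2 ⌝ ℚ.* ⌜ m ⌝
  ⌜+2*⌝ s m = trans (⌜⌝-+ s (2 * m)) (cong (⌜ s ⌝ ℚ.+_) (⌜⌝-* 2 m))
  2S*≤ : ⌜ 2 ⌝ ℚ.* S* ℚ.≤ ⌜ a ⌝ ℚ.* M*
  2S*≤ = subst₂ ℚ._≤_ (⌜⌝-* 2 s*) (⌜⌝-* a m*) (⌜⌝-mono-≤ s*≤)
  2M≤ : ⌜ 2 ⌝ ℚ.* M ℚ.≤ g ℚ.* S* ℚ.+ ⌜ 2 ⌝ ℚ.* M*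
  2M≤ = begin
    ⌜ 2 ⌝ ℚ.* M                                   ≡⟨ solve 2 (λ S X → X := :- S :+ (S :+ X)) refl S (⌜ 2 ⌝ ℚ.* M) ⟩
    ℚ.- S ℚ.+ (S ℚ.+ ⌜ 2 ⌝ ℚ.* M)                 ≡⟨ cong (ℚ.- S ℚ.+_) (trans (sym (⌜+2*⌝ s m)) (trans (cong ⌜_⌝ eq) (⌜+2*⌝ s* m*))) ⟩
    ℚ.- S ℚ.+ (S* ℚ.+ ⌜ 2 ⌝ ℚ.* M*)               ≡⟨ solve 4 (λ S S* g X → :- S :+ (S* :+ X) := :- S :+ ((con 1ℚ :+ :- g) :* S* :+ (g :* S* :+ X))) refl S S* g (⌜ 2 ⌝ ℚ.* M*) ⟩
    ℚ.- S ℚ.+ ((1ℚ ℚ.- g) ℚ.* S* ℚ.+ (g ℚ.* S* ℚ.+ ⌜ 2 ⌝ ℚ.* M*)) ≤⟨ ℚ.+-monoʳ-≤ (ℚ.- S) (ℚ.+-monoˡ-≤ (g ℚ.* S* ℚ.+ ⌜ 2 ⌝ ℚ.* M*) approx) ⟩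
    ℚ.- S ℚ.+ (S ℚ.+ (g ℚ.* S* ℚ.+ ⌜ 2 ⌝ ℚ.* M*)) ≡⟨ solve 2 (λ S X → X := :- S :+ (S :+ X)) refl S (g ℚ.* S* ℚ.+ ⌜ 2 ⌝ ℚ.* M*) ⟨
    g ℚ.* S* ℚ.+ ⌜ 2 ⌝ ℚ.* M*                     ∎

-- The cut is an image, so `above-q` already says that the preimage of `q` under the map from g to 1
-- + c g lies above γ.
above-1+c* : ∀ r γ q → above (1ℚ +ʳ 2^[ r -2]*ʳ γ) q →
  ∃[ g ] (above γ g × q ≡ 1ℚ ℚ.+ 2^[ r -2] ℚ.* g)
above-1+c* r γ q above-q = c⁻¹ ℚ.* (ℚ.- 1ℚ ℚ.+ q) , above-q , sym (begin
  1ℚ ℚ.+ c ℚ.* (c⁻¹ ℚ.* (ℚ.- 1ℚ ℚ.+ q))  ≡⟨ cong (1ℚ ℚ.+_) (ℚ.*-assoc c c⁻¹ _) ⟨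
  1ℚ ℚ.+ c ℚ.* c⁻¹ ℚ.* (ℚ.- 1ℚ ℚ.+ q)    ≡⟨ cong (λ d → 1ℚ ℚ.+ d ℚ.* (ℚ.- 1ℚ ℚ.+ q)) (ℚ.*-inverseʳ c {{c≢0}}) ⟩
  1ℚ ℚ.+ 1ℚ ℚ.* (ℚ.- 1ℚ ℚ.+ q)           ≡⟨ solve 1 (λ q → con 1ℚ :+ con 1ℚ :* (con (ℚ.- 1ℚ) :+ q) := q) refl q ⟩
  q                                      ∎)
  where
  open ≡-Reasoning
  open ℚ.+-*-Solver using (solve; _:*_; _:+_; _:=_; con)
  c = 2^[ r -2]
  c≢0 = ℚ.pos⇒nonZero c {{2^[-2]-positive r}}
  c⁻¹ = (ℚ.1/ c) {{c≢0}}

-- Allows inequalities to be multiplied by `g`: a negative rational above γ would, by roundedness,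
-- put 0 above γ.
above-nonNegative : ∀ γ → 0ℚ ≤ʳ γ → ∀ g → above γ g → 0ℚ ℚ.≤ g
above-nonNegative γ γ≥0 g a = ℚ.≮⇒≥ λ g<0 →
  γ≥0 (Equivalence.from (ℝ.above-rounded γ 0ℚ) (g , g<0 , a))

below-1- : ∀ γ g → above γ g → below (1ℚ +ʳ -ʳ γ) (1ℚ ℚ.- g)
below-1- γ g = subst (above γ)
  (solve 1 (λ g → g := :- (con (ℚ.- 1ℚ) :+ (con 1ℚ :+ :- g))) refl g)
  where open ℚ.+-*-Solver using (solve; _:+_; _:=_; :-_; con)

-- Solutions are carried back by a single `tl`, hence the shape `x ∙ _` required of the encoded
-- solution; dropping the head of an assignment removes the dummy variable.
solve-by-reduction : ∀ {Γ Δ red} → PolyTime Γ Δ red → ∀ P Q {Good Good′} →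
  let module P = Problem P ; module Q = Problem Q in
  (raw : P.Instance → ⟦ Γ ⟧) (reduce : P.Instance → Q.Instance) →
  (∀ I → enc Γ (raw I) ≡ P.encodeInstance I) →
  (∀ I → enc Δ (red (raw I)) ≡ Q.encodeInstance (reduce I)) →
  (∀ I s → Good′ (reduce I) s → Σ[ s′ ∈ P.Solution I ]
    (∃[ x ] Q.encodeSolution (reduce I) s ≡ x ∙ P.encodeSolution I s′) × Good I s′) →
  PolyTimeAlgorithm Q Good′ → PolyTimeAlgorithm P Good
solve-by-reduction {Γ} {Δ} {red} F P Q {Good} raw reduce encode-raw encode-red back (f , c , d , alg) =
  (program F ⨾ f ⨾ tl) , coefficient , degree , solution
  where
  module P = Problem P
  module Q = Problem Q
  totalTime : ⟦ Γ ⟧ → ℕ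
  totalTime γ = 1 + time F γ + (1 + c * ∣ Δ ∋ red γ ∣ ^ d + 1)
  totalTime-bounded : Bounded Γ totalTime
  totalTime-bounded = bounded-+ (bounded-+ (bounded-const 1) (time-bounded F))
    (bounded-+ (bounded-+ (bounded-const 1) (bounded-* (bounded-const c)
      (bounded-^ d (size-bounded F)))) (bounded-const 1))
  open Bounded totalTime-bounded
  solution : ∀ I → Σ[ s ∈ P.Solution I ] Σ[ t ∈ ℕ ]
    ((program F ⨾ f ⨾ tl) $ P.encodeInstance I ⇓[ t ] P.encodeSolution I s) ×
    t ≤ coefficient * size (P.encodeInstance I) ^ degree × Good I s
  solution I with alg (reduce I) | run F (raw I)
  ... | s , t , f-run , t≤ , s-good | u , F-run , u≤ with back I s s-good
  ...   | s′ , (x , eq) , s′-good = s′ , _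
    , seq (subst₂ (λ x y → program F $ x ⇓[ u ] y) (encode-raw I) (encode-red I) F-run)
          (seq (subst (f $ Q.encodeInstance (reduce I) ⇓[ t ]_) eq f-run) tl-∙)
    , (begin
      1 + u + (1 + t + 1)                                   ≤⟨ s≤s (+-mono-≤ u≤ (s≤s (+-monoˡ-≤ 1 (≤-trans t≤
        (≤-reflexive (cong (λ x → c * size x ^ d) (sym (encode-red I)))))))) ⟩
      totalTime (raw I)                                     ≤⟨ bound (raw I) ⟩
      coefficient * size (enc Γ (raw I)) ^ degree           ≡⟨ cong (λ x → coefficient * size x ^ degree) (encode-raw I) ⟩
      coefficient * size (P.encodeInstance I) ^ degree      ∎)
    , s′-good
    where open ≤-Reasoning

reduction-approximation : ∀ r .{{_ : NonZero r}} γ → 0ℚ ≤ʳ γ → ∀ I →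
  All (λ S → ∣ S ∣ ≤ r) (SM2Instance.scenarios I) → ∀ b A →
  (∀ α* → IsMaximum (MaxNaeSat r) (Reduction.naeInstance r I) α* →
    NaeInstance.satisfiedWeight (Reduction.naeInstance r I) (b ∷ A) AtLeast (1ℚ +ʳ -ʳ γ)
      Times NaeInstance.satisfiedWeight (Reduction.naeInstance r I) α*) →
  ∀ A* → (∀ A′ → SM2Instance.totalMakespan I A* ℚ.≤ SM2Instance.totalMakespan I A′) →
  SM2Instance.totalMakespan I A AtMost (1ℚ +ʳ 2^[ r -2]*ʳ γ) Times SM2Instance.totalMakespan I A*
reduction-approximation r γ γ≥0 I small b A α-approx A* minimal q above-q =
  let g , above-g , q≡ = above-1+c* r γ q above-q in
  subst (λ q → totalMakespan A ℚ.≤ q ℚ.* totalMakespan A*) (sym q≡) (bound g above-g)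
  where
  open SM2Instance I using (totalMakespan)
  open Reduction r I
  α  = b ∷ A
  -- Any value of the dummy variable would do.
  α* = true ∷ A*

  instance
    D-positive : ℚ.Positive ⌜ D ⌝
    D-positive = ⌜⌝-positive (scale-positive (tabulate (SM2Instance.p I)))

  D-nonNegative : ℚ.NonNegative ⌜ D ⌝
  D-nonNegative = ℚ.pos⇒nonNeg ⌜ D ⌝

  rearrange : ∀ q D p → q ℚ.* (D ℚ.* p) ≡ D ℚ.* (q ℚ.* p)
  rearrange = ring 3 (λ q D p → q :* (D :* p) := D :* (q :* p)) refl
    where open ℚ.+-*-Solver using (_:*_; _:=_) renaming (solve to ring)

  -- By constancy of satisfied weight plus twice the scaled makespan, a minimum partition is a
  -- maximum assignment, so the guarantee of the given algorithm can be invoked at `α*`.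
  maximal : ∀ β → NaeInstance.satisfiedWeight naeInstance β
              ℚ.≤ NaeInstance.satisfiedWeight naeInstance α*
  maximal β@(b′ ∷ A′) = subst₂ ℚ._≤_ (sym (satisfiedWeight-sat β)) (sym (satisfiedWeight-sat α*))
    (⌜⌝-mono-≤ (+-cancelʳ-≤ (2 * totalScaledMakespan α*) _ _ (begin
      totalSat β + 2 * totalScaledMakespan α*  ≤⟨ +-monoʳ-≤ (totalSat β) (*-monoʳ-≤ 2 (⌜⌝-cancel-≤
        (subst₂ ℚ._≤_ (sym (⌜totalScaledMakespan⌝ small true A*)) (sym (⌜totalScaledMakespan⌝ small b′ A′))
          (ℚ.*-monoˡ-≤-nonNeg ⌜ D ⌝ {{D-nonNegative}} (minimal A′))))) ⟩
      totalSat β + 2 * totalScaledMakespan β   ≡⟨ sat+makespan-constant β α* ⟩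
      totalSat α* + 2 * totalScaledMakespan α* ∎)))
    where open ≤-Reasoning

  bound : ∀ g → above γ g → totalMakespan A ℚ.≤ (1ℚ ℚ.+ 2^[ r -2] ℚ.* g) ℚ.* totalMakespan A*
  bound g above-g = ℚ.*-cancelˡ-≤-pos ⌜ D ⌝ (subst₂ ℚ._≤_
    (⌜totalScaledMakespan⌝ small b A)
    (trans (cong (q′ ℚ.*_) (⌜totalScaledMakespan⌝ small true A*))
           (rearrange q′ ⌜ D ⌝ (totalMakespan A*)))
    (makespan-bound (totalSat α) (totalSat α*) (totalScaledMakespan α) (totalScaledMakespan α*)
      (2 ^ r) 2^[ r -2] g (above-nonNegative γ γ≥0 g above-g) satisfied≥
      (sat+makespan-constant α α*) (totalSat≤ α*) (⌜4⌝*2^[-2] r)))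
    where
    q′ = 1ℚ ℚ.+ 2^[ r -2] ℚ.* g
    satisfied≥ : (1ℚ ℚ.- g) ℚ.* ⌜ totalSat α* ⌝ ℚ.≤ ⌜ totalSat α ⌝
    satisfied≥ = subst₂ (λ s* s → (1ℚ ℚ.- g) ℚ.* s* ℚ.≤ s)
      (satisfiedWeight-sat α*) (satisfiedWeight-sat α)
      (α-approx α* maximal (1ℚ ℚ.- g) (below-1- γ g above-g))

theorem7 : (r : ℕ) .{{_ : NonZero r}} (γ : ℝ) → 0ℚ ≤ʳ γ →
    MaxApproximation (MaxNaeSat r) (1ℚ +ʳ -ʳ γ) →
    MinApproximation (SM2WithScenarioSizeAtMost r) (1ℚ +ʳ 2^[ r -2]*ʳ γ)
theorem7 r γ γ≥0 = solve-by-reduction (rawReductionᵖ r) (SM2WithScenarioSizeAtMost r) (MaxNaeSat r)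
  (λ (I , _) → rawSM2 I) (λ (I , _) → Reduction.naeInstance r I)
  (λ (I , _) → encode-rawSM2 I)
  (λ (I , _) → trans (cong (enc naeᵗ) (Reduction.rawNae-naeInstance r I))
                     (encode-rawNae (Reduction.naeInstance r I)))
  (λ { (I , small) (b ∷ A) approx →
       A , (encodeBool b , refl) , reduction-approximation r γ γ≥0 I small b A approx })
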